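{- For all primes $p>3$, \[ \sum_{x=0}^{p-1}\, {}_3F_2\left[\begin{matrix}\frac{1-p}{2} & \frac{1+p}{2} & -x\\ & 1 & 1\end{matrix}\;;\;1\right]^2 \equiv (-1)^{\frac{p-1}{2}} \pmod{p^3}, \] and for all primes $p\ge 3$, \[ \sum_{x=0}^{p-1}\, {}_3F_2\left[\begin{matrix}\frac12 & \frac12 & -x\\ & 1 & 1\end{matrix}\;;\;1\right]^2 \equiv (-1)^{\frac{p-1}{2}} \pmod{p^3}. \]
   Context: For $a\in\mathbb{C}$, $(a)_0:=1$ and $(a)_k:=a(a+1)\cdots(a+k-1)$ for $k\ge 1$. The hypergeometric series is \[ {}_3F_2\left[\begin{matrix}\alpha_1 & \alpha_2 & \alpha_3\\ & \beta_1 & \beta_2\end{matrix}\;;\;\lambda\right]:=\sum_{k=0}^{\infty}\frac{(\alpha_1)_k(\alpha_2)_k(\alpha_3)_k}{(\beta_1)_k(\beta_2)_k}\cdot\frac{\lambda^k}{k!}. \] Since one upper parameter is $-x$ with $x$ a nonnegative integer, the series above are finite sums (only terms with $k\le x$ contribute) and take rational values; for instance \[ {}_3F_2\left[\begin{matrix}\frac12 & \frac12 & -x\\ & 1 & 1\end{matrix}\;;\;1\right]=\sum_{k=0}^{x}(-1)^k\binom{ -\frac12}{k}^2\binom{x}{k}. \] A congruence $a\equiv b\pmod{p^s}$ between rational numbers means $a-b\in p^s\mathbb{Z}_p$, where $\mathbb{Z}_p$ is the ring of $p$-adic integers (equivalently, $a-b$ is $p^s$ times a rational number whose denominator is prime to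 $p$). -}

module Defs where

open import Algebra.Definitions.RawSemiring using () renaming (_^_ to power)
open import Data.Fin.Base using (toℕ)
open import Data.Integer.Base using (+_)
open import Data.Nat.Base as ℕ using (ℕ; zero; suc; _!; z≤n; s≤s)
open import Data.Nat.Coprimality using (Coprime)
open import Data.Nat.Properties as ℕₚ using (_!≢0)
open import Data.Product.Base using (∃-syntax; _×_; _,_)
open import Data.Rational.Base
open import Data.Rational.Literals using (fromℤ)
open import Data.Rational.Properties
open import Function.Base using (_∘_)
open import Relation.Binary.PropositionalEquality.Core
  using (_≡_; refl; sym; trans; cong; cong₂)

import Algebra.Definitions.RawMonoid +-0-rawMonoid as Additive

fromℕ : ℕ → ℚ
fromℕ n = fromℤ (+ n)

infixr 8 _^_

_^_ : ℚ → ℕ → ℚ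
_^_ = power +-*-rawSemiring

sum-syntax : (n : ℕ) → (ℕ → ℚ) → ℚ
sum-syntax n f = Additive.sum {n} (f ∘ toℕ)

infixl 5 sum-syntax
syntax sum-syntax n (λ k → e) = ∑[ k < n ] e

-- ∑ₖ t k over all k : ℕ, for t vanishing from some index on.
EventuallyZero : (ℕ → ℚ) → Set
EventuallyZero t = ∃[ n ] (∀ k → n ℕ.≤ k → t k ≡ 0ℚ)

series : (t : ℕ → ℚ) → EventuallyZero t → ℚ
series t (n , _) = ∑[ k < n ] t k

-- The value does not depend on the chosen bound.
series-unique : ∀ t (z z′ : EventuallyZero t) → series t z ≡ series t z′
series-unique t (n , z) (m , w) = go t n m z w
  where
  go : ∀ t n m → (∀ k → n ℕ.≤ k → t k ≡ 0ℚ) → (∀ k → m ℕ.≤ k → t k ≡ 0ℚ) →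
       ∑[ k < n ] t k ≡ ∑[ k < m ] t k
  go t zero    zero    z w = refl
  go t zero    (suc m) z w =
    trans (sym (+-identityˡ 0ℚ))
          (cong₂ _+_ (sym (z 0 z≤n))
                     (go (t ∘ suc) zero m (λ k _ → z (suc k) z≤n) (λ k → w (suc k) ∘ s≤s)))
  go t (suc n) zero    z w =
    trans (cong₂ _+_ (w 0 z≤n)
                     (go (t ∘ suc) n zero (λ k → z (suc k) ∘ s≤s) (λ k _ → w (suc k) z≤n)))
          (+-identityˡ 0ℚ)
  go t (suc n) (suc m) z w =
    cong (λ r → t 0 + r)
         (go (t ∘ suc) n m (λ k → z (suc k) ∘ s≤s) (λ k → w (suc k) ∘ s≤s))

pochhammer : ℚ → ℕ → ℚ
pochhammer a zero    = 1ℚ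
pochhammer a (suc k) = pochhammer a k * (a + fromℕ k)

-- Equivalently, β is not a nonpositive integer.
record LowerParameter (β : ℚ) : Set where
  field
    pochhammer≢0 : ∀ k → NonZero (pochhammer β k)

open LowerParameter public

instance
  1-lowerParameter : LowerParameter 1ℚ
  1-lowerParameter .pochhammer≢0 k = pos⇒nonZero (pochhammer 1ℚ k) {{positive′ k}}
    where
    positive′ : ∀ k → Positive (pochhammer 1ℚ k)
    positive′ zero    = _
    positive′ (suc k) =
      pos*pos⇒pos (pochhammer 1ℚ k) {{positive′ k}}
                  (1ℚ + fromℕ k) {{pos+nonNeg⇒pos 1ℚ (fromℕ k)}}

₃F₂-term : (α₁ α₂ α₃ β₁ β₂ : ℚ) .{{_ : LowerParameter β₁}} .{{_ : LowerParameter β₂}}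
           (z : ℚ) → ℕ → ℚ
₃F₂-term α₁ α₂ α₃ β₁ β₂ {{l₁}} {{l₂}} z k =
  (pochhammer α₁ k * pochhammer α₂ k * pochhammer α₃ k
    ÷ pochhammer β₁ k) {{pochhammer≢0 l₁ k}}
  * (1/ pochhammer β₂ k) {{pochhammer≢0 l₂ k}}
  * (z ^ k * ((+ 1) / (k !)) {{k !≢0}})

₃F₂ : (α₁ α₂ α₃ β₁ β₂ : ℚ) .{{_ : LowerParameter β₁}} .{{_ : LowerParameter β₂}}
      (z : ℚ) → EventuallyZero (₃F₂-term α₁ α₂ α₃ β₁ β₂ z) → ℚ
₃F₂ α₁ α₂ α₃ β₁ β₂ z = series (₃F₂-term α₁ α₂ α₃ β₁ β₂ z)

pochhammer-vanishes : ∀ x {k} → x ℕ.<′ k → pochhammer (- fromℕ x) k ≡ 0ℚ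
pochhammer-vanishes x ℕ.≤′-refl =
  trans (cong (pochhammer (- fromℕ x) x *_) (+-inverseˡ (fromℕ x)))
        (*-zeroʳ (pochhammer (- fromℕ x) x))
pochhammer-vanishes x (ℕ.≤′-step {k} x<k) =
  trans (cong (_* (- fromℕ x + fromℕ k)) (pochhammer-vanishes x x<k))
        (*-zeroˡ (- fromℕ x + fromℕ k))

terminates : ∀ α₁ α₂ x β₁ β₂ .{{_ : LowerParameter β₁}} .{{_ : LowerParameter β₂}} z →
             EventuallyZero (₃F₂-term α₁ α₂ (- fromℕ x) β₁ β₂ z)
terminates α₁ α₂ x β₁ β₂ {{l₁}} {{l₂}} z = suc x , vanishes
  where
  vanishes : ∀ k → x ℕ.< k → ₃F₂-term α₁ α₂ (- fromℕ x) β₁ β₂ z k ≡ 0ℚ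
  vanishes k x<k
    rewrite pochhammer-vanishes x (ℕₚ.≤⇒≤′ x<k)
          | *-zeroʳ (pochhammer α₁ k * pochhammer α₂ k)
          | *-zeroˡ ((1/ pochhammer β₁ k) {{pochhammer≢0 l₁ k}})
          | *-zeroˡ ((1/ pochhammer β₂ k) {{pochhammer≢0 l₂ k}})
          = *-zeroˡ (z ^ k * ((+ 1) / (k !)) {{k !≢0}})

-- For p prime: a - b ∈ pˢ ℤₚ, i.e. a - b is pˢ times a rational number whose
-- denominator is prime to p.
infix 4 _≡_[mod_^_]

_≡_[mod_^_] : ℚ → ℚ → ℕ → ℕ → Set
a ≡ b [mod p ^ s ] =
  ∃[ c ] Coprime p (↧ₙ c) × a - b ≡ fromℕ p ^ s * c

{-# OPTIONS --safe #-}

-- Write Φ z = ∑ₖ (a)ₖ(b)ₖ(z)ₖ/k!³, so that the summands are Φ(-x)². For a = -n and b = 1 + n,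
-- where p = 2n + 1, Φ is a Bateman polynomial and satisfies a second order
-- difference equation invariant under z ↦ 1 - z, whence Φ(-x) = (-1)ⁿ Φ(1 + x). The sum of the
-- products (-x)ₖ(1 + x)ⱼ over x < p has a closed form of hockey stick type, and turns ∑ₓ Φ(-x)²
-- into (-1)ⁿ ∑ⱼₖ dⱼdₖ p/(j+k+1) uⱼvₖ with dₖ the coefficients of the Legendre polynomial on [0,1],
-- uⱼ = ∏(1 + p/i) and vₖ = ∏(1 - p/i). Without the factors uⱼvₖ this is p times the norm
-- 1/(2n + 1) of the Legendre polynomial, i.e. 1. The average of uⱼvₖ and uₖvⱼ
-- differs from 1 by a multiple of p², and the weight is divisible by p unless j = k = n; there one
-- uses uₙvₙ ≡ 1 - p² ∑ 1/i² modulo p³ and ∑ 1/i² ≡ 0 modulo p.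
--
-- For a = b = ½ the coefficients are dₖ + p² eₖ with p-integral eₖ, and the cross term
-- ∑ₓ Φ(-x) ∑ₖ eₖ (-x)ₖ/k! must vanish modulo p. The closed form reduces it modulo p to the
-- antidiagonal j + k = 2n, where it is dₙ² times the sum of 1/t² over 0 < t < p.

module Submission where

open import Defs
open import Algebra.Bundles using (CommutativeRing)
import Algebra.Properties.CommutativeMonoid.Sum as CommutativeMonoidSum
import Algebra.Properties.Semiring.Sum as SemiringSum
open import Data.Fin.Base using (toℕ)
open import Data.Integer.Base as ℤ using (ℤ; 1ℤ; +_; +0; +[1+_]; -[1+_])
import Data.Integer.Properties as ℤₚ
open import Data.List.Base using ([]; _∷_)
open import Data.Nat.Base as ℕ using (ℕ; zero; suc; _∸_; _<_; _≤_; _!; s≤s; z≤n; z<s; s<s)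
open import Data.Nat.Coprimality as Coprimality using (Coprime)
open import Data.Nat.DivMod using (m*n/n≡m)
open import Data.Nat.Divisibility as ∣ using (_∣_; _∤_)
open import Data.Nat.Primality
  using (Prime; euclidsLemma; prime⇒irreducible; prime⇒nonTrivial)
import Data.Nat.Properties as ℕₚ
open import Data.Product.Base using (_×_; _,_; proj₁; proj₂; ∃-syntax)
open import Data.Rational.Base
  using (ℚ; mkℚ; 0ℚ; 1ℚ; ½; _+_; _*_; -_; _-_; 1/_; _/_; ↥_; ↧_; ↧ₙ_; toℚᵘ)
open import Data.Rational.Literals using (fromℤ)
open import Data.Rational.Properties
import Data.Rational.Unnormalised.Base as ℚᵘ
import Data.Rational.Unnormalised.Properties as ℚᵘₚ
open import Data.Sum.Base using (_⊎_; inj₁; inj₂)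
open import Function.Base using (_∘_)
open import Level using (0ℓ)
open import Relation.Binary.PropositionalEquality
open import Relation.Nullary using (yes; no; contradiction)
open import Relation.Nullary.Decidable using (dec⇒maybe)
open import Tactic.RingSolver using (solve-∀; solve)
open import Tactic.RingSolver.Core.AlmostCommutativeRing
  using (AlmostCommutativeRing; fromCommutativeRing)

-- Polynomial identities and linear combinations of hypotheses.

ring : AlmostCommutativeRing 0ℓ 0ℓ
ring = fromCommutativeRing +-*-commutativeRing (λ x → dec⇒maybe (0ℚ ≟ x))

module ΣM = CommutativeMonoidSum +-0-commutativeMonoid
module ΣR = SemiringSum (CommutativeRing.semiring +-*-commutativeRing)

2ℚ 4ℚ : ℚ
2ℚ = + 2 / 1
4ℚ = + 4 / 1

x-y≡0⇒x≡y : ∀ {x y} → x - y ≡ 0ℚ → x ≡ y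
x-y≡0⇒x≡y {x} {y} h = trans (split x y) (trans (cong (_+ y) h) (+-identityˡ y))
  where
  split : ∀ x y → x ≡ (x - y) + y
  split = solve-∀ ring

-- Both operators bind more weakly than the ring operations, so the multiplier to the left of `_·_`
-- may be a sum or a difference without parentheses.
infix 5 _·_
infixl 4 _⊞_

_·_ : ∀ q {a b} → a ≡ b → q * (a - b) ≡ 0ℚ
_·_ q {a} refl = vanish q a
  where
  vanish : ∀ q a → q * (a - a) ≡ 0ℚ
  vanish = solve-∀ ring

_⊞_ : ∀ {x y} → x ≡ 0ℚ → y ≡ 0ℚ → x + y ≡ 0ℚ
refl ⊞ refl = refl

-- x ≡ y follows from hypotheses aᵢ ≡ bᵢ once x - y is exhibited as ∑ qᵢ (aᵢ - bᵢ).
linear : ∀ {x y z} → z ≡ 0ℚ → x - y ≡ z → x ≡ y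
linear p q = x-y≡0⇒x≡y (trans q p)

-- The integers inside the rationals.

fromℤ-/1 : ∀ i → i / 1 ≡ fromℤ i
fromℤ-/1 i = ↥p/↧p≡p (fromℤ i)

fromℤ-+ : ∀ i j → fromℤ (i ℤ.+ j) ≡ fromℤ i + fromℤ j
fromℤ-+ i j = trans (sym (fromℤ-/1 (i ℤ.+ j)))
  (cong (_/ 1) (sym (cong₂ ℤ._+_ (ℤₚ.*-identityʳ i) (ℤₚ.*-identityʳ j))))

fromℤ-* : ∀ i j → fromℤ (i ℤ.* j) ≡ fromℤ i * fromℤ j
fromℤ-* i j = sym (fromℤ-/1 (i ℤ.* j))

fromℤ-neg : ∀ i → fromℤ (ℤ.- i) ≡ - fromℤ i
fromℤ-neg +0       = refl
fromℤ-neg +[1+ n ] = refl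
fromℤ-neg -[1+ n ] = refl

fromℤ-injective : ∀ {i j} → fromℤ i ≡ fromℤ j → i ≡ j
fromℤ-injective = cong ↥_

fromℕ-+ : ∀ m n → fromℕ (m ℕ.+ n) ≡ fromℕ m + fromℕ n
fromℕ-+ m n = fromℤ-+ (+ m) (+ n)

fromℕ-* : ∀ m n → fromℕ (m ℕ.* n) ≡ fromℕ m * fromℕ n
fromℕ-* m n = trans (cong fromℤ (ℤₚ.pos-* m n)) (fromℤ-* (+ m) (+ n))

fromℕ-suc : ∀ n → fromℕ (suc n) ≡ 1ℚ + fromℕ n
fromℕ-suc n = fromℕ-+ 1 n

-- The shift by one makes the reciprocal total. It also fits the main use: `recip (j + k)` is the
-- integral of tʲ⁺ᵏ over [0,1].
recip : ℕ → ℚ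
recip k = 1/ fromℕ (suc k)

recip-inverse : ∀ k → (1ℚ + fromℕ k) * recip k ≡ 1ℚ
recip-inverse k = trans (cong (_* recip k) (sym (fromℕ-suc k))) (*-inverseʳ (fromℕ (suc k)))

recip-inverse′ : ∀ k → fromℕ (suc k) * recip k ≡ 1ℚ
recip-inverse′ k = *-inverseʳ (fromℕ (suc k))

-- Finite sums.

∑-cong : ∀ n (f g : ℕ → ℚ) → (∀ k → k < n → f k ≡ g k) → ∑[ k < n ] f k ≡ ∑[ k < n ] g k
∑-cong zero    f g h = refl
∑-cong (suc n) f g h = cong₂ _+_ (h 0 z<s) (∑-cong n (f ∘ suc) (g ∘ suc) (λ k → h (suc k) ∘ s<s))

∑-last : ∀ n (f : ℕ → ℚ) → ∑[ k < suc n ] f k ≡ (∑[ k < n ] f k) + f n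
∑-last zero    f = +-comm (f 0) 0ℚ
∑-last (suc n) f = trans (cong (λ r → f 0 + r) (∑-last n (f ∘ suc))) (sym (+-assoc (f 0) _ (f (suc n))))

∑-+ : ∀ n (f g : ℕ → ℚ) → ∑[ k < n ] (f k + g k) ≡ (∑[ k < n ] f k) + (∑[ k < n ] g k)
∑-+ n f g = ΣM.∑-distrib-+ {n} (f ∘ toℕ) (g ∘ toℕ)

∑-*ˡ : ∀ n c (f : ℕ → ℚ) → ∑[ k < n ] (c * f k) ≡ c * (∑[ k < n ] f k)
∑-*ˡ n c f = sym (ΣR.*-distribˡ-sum {n} c (f ∘ toℕ))

∑-*ʳ : ∀ n (f : ℕ → ℚ) c → ∑[ k < n ] (f k * c) ≡ (∑[ k < n ] f k) * c
∑-*ʳ n f c = sym (ΣR.*-distribʳ-sum {n} c (f ∘ toℕ))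

∑-swap : ∀ m n (f : ℕ → ℕ → ℚ) →
         ∑[ i < m ] (∑[ j < n ] f i j) ≡ ∑[ j < n ] (∑[ i < m ] f i j)
∑-swap m n f = ΣM.∑-comm {m} {n} (λ i j → f (toℕ i) (toℕ j))

∑-zero : ∀ n (f : ℕ → ℚ) → (∀ k → k < n → f k ≡ 0ℚ) → ∑[ k < n ] f k ≡ 0ℚ
∑-zero n f h = trans (∑-cong n f (λ _ → 0ℚ) h) (ΣM.sum-replicate-zero n)

∑-reverse : ∀ n (f : ℕ → ℚ) → ∑[ k < n ] f k ≡ ∑[ k < n ] f (n ∸ suc k)
∑-reverse zero    f = refl
∑-reverse (suc n) f = trans (∑-last n f)
  (trans (+-comm _ (f n)) (cong (λ r → f n + r) (∑-reverse n f)))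

-- Normalised rising factorials.

-- rise z k = (z)ₖ / k!
rise : ℚ → ℕ → ℚ
rise z zero    = 1ℚ
rise z (suc k) = rise z k * (z + fromℕ k) * recip k

rise-suc : ∀ z k → (1ℚ + fromℕ k) * rise z (suc k) ≡ rise z k * (z + fromℕ k)
rise-suc z k = alg (fromℕ k) (recip k) (rise z k) z (recip-inverse k)
  where
  alg : ∀ k i r z → (1ℚ + k) * i ≡ 1ℚ → (1ℚ + k) * (r * (z + k) * i) ≡ r * (z + k)
  alg k i r z h = linear (r * (z + k) · h) (solve (k ∷ i ∷ r ∷ z ∷ []) ring)

-- Both sides are (z)ₖ₊₁/k!, with either the first or the last factor split off.
rise-shift : ∀ z k → z * rise (z + 1ℚ) k ≡ (z + fromℕ k) * rise z k
rise-shift z zero    = alg z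
  where
  alg : ∀ z → z * 1ℚ ≡ (z + 0ℚ) * 1ℚ
  alg = solve-∀ ring
rise-shift z (suc k) =
  alg z (fromℕ k) (fromℕ (suc k)) (recip k) (rise z k) (rise (z + 1ℚ) k) (rise-shift z k) (fromℕ-suc k)
  where
  alg : ∀ z k k′ i r r′ → z * r′ ≡ (z + k) * r → k′ ≡ 1ℚ + k →
        z * (r′ * (z + 1ℚ + k) * i) ≡ (z + k′) * (r * (z + k) * i)
  alg z k k′ i r r′ h h′ = linear ((z + 1ℚ + k) * i · h ⊞ - (r * (z + k) * i) · h′)
    (solve (z ∷ k ∷ k′ ∷ i ∷ r ∷ r′ ∷ []) ring)

rise-front : ∀ z k → (1ℚ + fromℕ k) * rise z (suc k) ≡ z * rise (z + 1ℚ) k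
rise-front z k = trans (rise-suc z k) (trans (*-comm (rise z k) _) (sym (rise-shift z k)))

-- Pascal's rule, since `rise z k` is the binomial coefficient of z + k - 1 over k.
rise-pascal : ∀ z k → rise (z + 1ℚ) (suc k) - rise z (suc k) ≡ rise (z + 1ℚ) k
rise-pascal z k = alg z (fromℕ k) (recip k) (rise z k) (rise (z + 1ℚ) k)
                      (rise-shift z k) (recip-inverse k)
  where
  alg : ∀ z k i r r′ → z * r′ ≡ (z + k) * r → (1ℚ + k) * i ≡ 1ℚ →
        r′ * (z + 1ℚ + k) * i - r * (z + k) * i ≡ r′
  alg z k i r r′ h h′ = linear (i · h ⊞ r′ · h′) (solve (z ∷ k ∷ i ∷ r ∷ r′ ∷ []) ring)

rise-0 : ∀ k → rise 0ℚ (suc k) ≡ 0ℚ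
rise-0 zero    = refl
rise-0 (suc k) = trans (cong (λ r → r * (0ℚ + fromℕ (suc k)) * recip (suc k)) (rise-0 k))
                       (alg (0ℚ + fromℕ (suc k)) (recip (suc k)))
  where
  alg : ∀ x i → 0ℚ * x * i ≡ 0ℚ
  alg = solve-∀ ring

rise-1 : ∀ k → rise 1ℚ k ≡ 1ℚ
rise-1 zero    = refl
rise-1 (suc k) = trans (cong (λ r → r * (1ℚ + fromℕ k) * recip k) (rise-1 k))
  (trans (alg (1ℚ + fromℕ k) (recip k)) (recip-inverse k))
  where
  alg : ∀ x i → 1ℚ * x * i ≡ x * i
  alg = solve-∀ ring

-- The order `_<′_` puts the base case at the index n + 1, where the factor -n + n first enters;
-- later factors keep the product zero.
rise-vanishes : ∀ n {k} → n ℕ.<′ k → rise (- fromℕ n) k ≡ 0ℚ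
rise-vanishes n ℕ.≤′-refl = alg (rise (- fromℕ n) n) (fromℕ n) (recip n)
  where
  alg : ∀ r n i → r * (- n + n) * i ≡ 0ℚ
  alg = solve-∀ ring
rise-vanishes n (ℕ.≤′-step {k} n<k) =
  trans (cong (λ r → r * (- fromℕ n + fromℕ k) * recip k) (rise-vanishes n n<k))
        (alg (- fromℕ n + fromℕ k) (recip k))
  where
  alg : ∀ x i → 0ℚ * x * i ≡ 0ℚ
  alg = solve-∀ ring

-- The difference equation of Φ and the partial sums of Legendre coefficients

cancel-suc : ∀ k {x} → (1ℚ + fromℕ k) * x ≡ 0ℚ → x ≡ 0ℚ
cancel-suc k {x} h = alg (fromℕ k) (recip k) x (recip-inverse k) h
  where
  alg : ∀ k i x → (1ℚ + k) * i ≡ 1ℚ → (1ℚ + k) * x ≡ 0ℚ → x ≡ 0ℚ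
  alg k i x h h′ = linear (- x · h ⊞ i · h′) (solve (k ∷ i ∷ x ∷ []) ring)

coeff : ℚ → ℚ → ℕ → ℚ
coeff a b k = rise a k * rise b k

coeff-suc : ∀ a b k → (1ℚ + fromℕ k) * (1ℚ + fromℕ k) * coeff a b (suc k)
                    ≡ (a + fromℕ k) * (b + fromℕ k) * coeff a b k
coeff-suc a b k = alg a b (fromℕ k) (rise a k) (rise b k) (rise a (suc k)) (rise b (suc k))
                      (rise-suc a k) (rise-suc b k)
  where
  alg : ∀ a b k r s r′ s′ → (1ℚ + k) * r′ ≡ r * (a + k) → (1ℚ + k) * s′ ≡ s * (b + k) →
        (1ℚ + k) * (1ℚ + k) * (r′ * s′) ≡ (a + k) * (b + k) * (r * s)
  alg a b k r s r′ s′ h h′ = linear ((1ℚ + k) * s′ · h ⊞ r * (a + k) · h′)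
    (solve (a ∷ b ∷ k ∷ r ∷ s ∷ r′ ∷ s′ ∷ []) ring)

-- The truncation is explicit so that one expression serves both cases: for Legendre coefficients
-- the sum stops by itself after k = n, for a = b = ½ it stops only because z = -x.
Φ : ℚ → ℚ → ℕ → ℚ → ℚ
Φ a b M z = ∑[ k < M ] (coeff a b k * rise z k)

-- By Pascal's rule the two differences on the left are `- rise (w + 1) k` and `rise (w + 2) k`. The
-- operator thus maps the basis function of index k + 1 into the span of those of index k + 1 and k
-- at w + 1, which is the shape needed for telescoping.
rise-difference : ∀ w k →
  w * w * (rise w (suc k) - rise (w + 1ℚ) (suc k))
  + (w + 1ℚ) * (w + 1ℚ) * (rise (w + 1ℚ + 1ℚ) (suc k) - rise (w + 1ℚ) (suc k))
  ≡ (1ℚ + fromℕ k) * (1ℚ + fromℕ (suc k)) * rise (w + 1ℚ) (suc k)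
    - (1ℚ + fromℕ k) * (1ℚ + fromℕ k) * rise (w + 1ℚ) k
rise-difference w k =
  alg w (fromℕ k) (fromℕ (suc k)) (rise w (suc k)) (rise (w + 1ℚ) (suc k))
      (rise (w + 1ℚ + 1ℚ) (suc k)) (rise (w + 1ℚ) k) (rise (w + 1ℚ + 1ℚ) k)
      (rise-pascal w k) (rise-pascal (w + 1ℚ) k) (rise-shift (w + 1ℚ) k)
      (rise-suc (w + 1ℚ) k) (fromℕ-suc k)
  where
  alg : ∀ w k k′ s₀ s₁ s₂ r r₂ →
    s₁ - s₀ ≡ r → s₂ - s₁ ≡ r₂ → (w + 1ℚ) * r₂ ≡ (w + 1ℚ + k) * r →
    (1ℚ + k) * s₁ ≡ r * (w + 1ℚ + k) → k′ ≡ 1ℚ + k →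
    w * w * (s₀ - s₁) + (w + 1ℚ) * (w + 1ℚ) * (s₂ - s₁)
    ≡ (1ℚ + k) * (1ℚ + k′) * s₁ - (1ℚ + k) * (1ℚ + k) * r
  alg w k k′ s₀ s₁ s₂ r r₂ h₁ h₂ h₃ h₄ h₅ = linear
    (- (w * w) · h₁ ⊞ (w + 1ℚ) * (w + 1ℚ) · h₂ ⊞ w + 1ℚ · h₃ ⊞ - (1ℚ + (1ℚ + k)) · h₄
     ⊞ - ((1ℚ + k) * s₁) · h₅)
    (solve (w ∷ k ∷ k′ ∷ s₀ ∷ s₁ ∷ s₂ ∷ r ∷ r₂ ∷ []) ring)

-- The difference equation is termwise a telescoping sum.
Φ-difference : ∀ a b M w → a + b ≡ 1ℚ →
  w * w * (Φ a b (suc M) w - Φ a b (suc M) (w + 1ℚ))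
  + (w + 1ℚ) * (w + 1ℚ) * (Φ a b (suc M) (w + 1ℚ + 1ℚ) - Φ a b (suc M) (w + 1ℚ))
  + a * b * Φ a b (suc M) (w + 1ℚ)
  ≡ (1ℚ + fromℕ M) * (1ℚ + fromℕ M) * coeff a b (suc M) * rise (w + 1ℚ) M
Φ-difference a b zero w a+b≡1 = alg a b w
  where
  alg : ∀ a b w →
    w * w * (1ℚ * 1ℚ * 1ℚ + 0ℚ - (1ℚ * 1ℚ * 1ℚ + 0ℚ))
    + (w + 1ℚ) * (w + 1ℚ) * (1ℚ * 1ℚ * 1ℚ + 0ℚ - (1ℚ * 1ℚ * 1ℚ + 0ℚ))
    + a * b * (1ℚ * 1ℚ * 1ℚ + 0ℚ)
    ≡ (1ℚ + 0ℚ) * (1ℚ + 0ℚ) * (1ℚ * (a + 0ℚ) * 1ℚ * (1ℚ * (b + 0ℚ) * 1ℚ)) * 1ℚ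
  alg = solve-∀ ring
Φ-difference a b (suc M) w a+b≡1
  rewrite ∑-last (suc M) (λ k → coeff a b k * rise w k)
        | ∑-last (suc M) (λ k → coeff a b k * rise (w + 1ℚ) k)
        | ∑-last (suc M) (λ k → coeff a b k * rise (w + 1ℚ + 1ℚ) k)
        = alg a b w (fromℕ M) (fromℕ (suc M)) (coeff a b (suc M)) (coeff a b (suc (suc M)))
            (Φ a b (suc M) w) (Φ a b (suc M) (w + 1ℚ)) (Φ a b (suc M) (w + 1ℚ + 1ℚ))
            (rise w (suc M)) (rise (w + 1ℚ) (suc M)) (rise (w + 1ℚ + 1ℚ) (suc M)) (rise (w + 1ℚ) M)
            (Φ-difference a b M w a+b≡1) (rise-difference w M) (coeff-suc a b (suc M))
            a+b≡1 (fromℕ-suc M)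
  where
  alg : ∀ a b w k k′ c c′ F₀ F₁ F₂ s₀ s₁ s₂ r →
    w * w * (F₀ - F₁) + (w + 1ℚ) * (w + 1ℚ) * (F₂ - F₁) + a * b * F₁
      ≡ (1ℚ + k) * (1ℚ + k) * c * r →
    w * w * (s₀ - s₁) + (w + 1ℚ) * (w + 1ℚ) * (s₂ - s₁)
      ≡ (1ℚ + k) * (1ℚ + k′) * s₁ - (1ℚ + k) * (1ℚ + k) * r →
    (1ℚ + k′) * (1ℚ + k′) * c′ ≡ (a + k′) * (b + k′) * c →
    a + b ≡ 1ℚ → k′ ≡ 1ℚ + k →
    w * w * (F₀ + c * s₀ - (F₁ + c * s₁))
    + (w + 1ℚ) * (w + 1ℚ) * (F₂ + c * s₂ - (F₁ + c * s₁))
    + a * b * (F₁ + c * s₁)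
    ≡ (1ℚ + k′) * (1ℚ + k′) * c′ * s₁
  -- This is where a + b = 1 enters: (a + k′)(b + k′) - ab = k′(k′ + a + b) has to equal k′(k′ + 1).
  alg a b w k k′ c c′ F₀ F₁ F₂ s₀ s₁ s₂ r h₁ h₂ h₃ h₄ h₅ = linear
    (1ℚ · h₁ ⊞ c · h₂ ⊞ - s₁ · h₃ ⊞ - (c * s₁ * k′) · h₄ ⊞ - (c * s₁ * (1ℚ + k′)) · h₅)
    (solve (a ∷ b ∷ w ∷ k ∷ k′ ∷ c ∷ c′ ∷ F₀ ∷ F₁ ∷ F₂ ∷ s₀ ∷ s₁ ∷ s₂ ∷ r ∷ []) ring)

-- For a natural number m this is the coefficient of tᵏ in the shifted Legendre polynomial Pₘ(1 -
-- 2t), namely (-1)ᵏ times the binomials of m over k and of m + k over k.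
legendre : ℚ → ℕ → ℚ
legendre m = coeff (- m) (1ℚ + m)

-[1+m]+1≡-m : ∀ m → - (1ℚ + m) + 1ℚ ≡ - m
-[1+m]+1≡-m = solve-∀ ring

rise-lower : ∀ m k → (1ℚ + m) * rise (- m) k ≡ (1ℚ + m - fromℕ k) * rise (- (1ℚ + m)) k
rise-lower m k = alg m (fromℕ k) (rise (- m) k) (rise (- (1ℚ + m) + 1ℚ) k) (rise (- (1ℚ + m)) k)
  (cong (λ z → rise z k) (-[1+m]+1≡-m m)) (rise-shift (- (1ℚ + m)) k)
  where
  alg : ∀ m k r s t → s ≡ r → - (1ℚ + m) * s ≡ (- (1ℚ + m) + k) * t →
        (1ℚ + m) * r ≡ (1ℚ + m - k) * t
  alg m k r s t h h′ = linear (- (1ℚ + m) · h ⊞ - 1ℚ · h′)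
    (solve (m ∷ k ∷ r ∷ s ∷ t ∷ []) ring)

rise-upper : ∀ m k → (1ℚ + m) * rise (1ℚ + (1ℚ + m)) k ≡ (1ℚ + m + fromℕ k) * rise (1ℚ + m) k
rise-upper m k = trans (cong (λ z → (1ℚ + m) * rise z k) (+-comm 1ℚ (1ℚ + m))) (rise-shift (1ℚ + m) k)

rise-lower-front : ∀ m k → (1ℚ + fromℕ k) * rise (- (1ℚ + m)) (suc k) ≡ - (1ℚ + m) * rise (- m) k
rise-lower-front m k = trans (rise-front (- (1ℚ + m)) k)
  (cong (λ z → - (1ℚ + m) * rise z k) (-[1+m]+1≡-m m))

legendre-step : ∀ m k → (1ℚ + m - fromℕ k) * legendre (1ℚ + m) k ≡ (1ℚ + m + fromℕ k) * legendre m k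
legendre-step m k =
  alg m (fromℕ k) (rise (- m) k) (rise (- (1ℚ + m)) k) (rise (1ℚ + m) k) (rise (1ℚ + (1ℚ + m)) k)
      (rise-lower m k) (rise-upper m k)
  where
  alg : ∀ m k α α′ β β′ → (1ℚ + m) * α ≡ (1ℚ + m - k) * α′ → (1ℚ + m) * β′ ≡ (1ℚ + m + k) * β →
        (1ℚ + m - k) * (α′ * β′) ≡ (1ℚ + m + k) * (α * β)
  alg m k α α′ β β′ h h′ = linear (- β′ · h ⊞ α · h′) (solve (m ∷ k ∷ α ∷ α′ ∷ β ∷ β′ ∷ []) ring)

-- The sums over neighbouring degrees telescope to a multiple of `legendre m M`. This vanishes as
-- soon as M exceeds a natural number m, so the total of all coefficients changes sign from one
-- degree to the next.
legendre-partial-sums : ∀ m M →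
  (1ℚ + m) * (∑[ k < suc M ] (legendre (1ℚ + m) k + legendre m k))
  ≡ 2ℚ * (1ℚ + m + fromℕ M) * legendre m M
legendre-partial-sums m zero = alg m
  where
  alg : ∀ m → (1ℚ + m) * (1ℚ * 1ℚ + 1ℚ * 1ℚ + 0ℚ) ≡ 2ℚ * (1ℚ + m + 0ℚ) * (1ℚ * 1ℚ)
  alg = solve-∀ ring
legendre-partial-sums m (suc M)
  rewrite ∑-last (suc M) (λ k → legendre (1ℚ + m) k + legendre m k)
        = alg m (fromℕ M) (fromℕ (suc M)) (recip M)
            (∑[ k < suc M ] (legendre (1ℚ + m) k + legendre m k))
            (rise (- m) M) (rise (- (1ℚ + m)) (suc M)) (rise (1ℚ + m) M) (rise (1ℚ + (1ℚ + m)) (suc M))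
            (legendre-partial-sums m M) (rise-lower-front m M) (rise-upper m (suc M))
            (recip-inverse M) (fromℕ-suc M)
  where
  alg : ∀ m k k′ i S α α′ β β′ →
    (1ℚ + m) * S ≡ 2ℚ * (1ℚ + m + k) * (α * β) →
    (1ℚ + k) * α′ ≡ - (1ℚ + m) * α →
    (1ℚ + m) * β′ ≡ (1ℚ + m + k′) * (β * (1ℚ + m + k) * i) →
    (1ℚ + k) * i ≡ 1ℚ → k′ ≡ 1ℚ + k →
    (1ℚ + m) * (S + (α′ * β′ + α * (- m + k) * i * (β * (1ℚ + m + k) * i)))
    ≡ 2ℚ * (1ℚ + m + k′) * (α * (- m + k) * i * (β * (1ℚ + m + k) * i))
  alg m k k′ i S α α′ β β′ h₁ h₂ h₃ h₄ h₅ = linear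
    (1ℚ · h₁
     ⊞ β * (1ℚ + m + k) * i * i * (1ℚ + m + k′) · h₂
     ⊞ α′ · h₃
     ⊞ - (1ℚ + (1ℚ + k) * i) * 2ℚ * (1ℚ + m + k) * α * β
       - β * (1ℚ + m + k) * i * (1ℚ + m + k′) * α′ · h₄
     ⊞ - (α * β * (1ℚ + m + k) * (1ℚ + m) * i * i)
       - 2ℚ * α * β * (k - m) * (1ℚ + m + k) * i * i · h₅)
    (solve (m ∷ k ∷ k′ ∷ i ∷ S ∷ α ∷ α′ ∷ β ∷ β′ ∷ []) ring)

legendre-vanishes : ∀ n {k} → n < k → legendre (fromℕ n) k ≡ 0ℚ
legendre-vanishes n {k} n<k = trans
  (cong (_* rise (1ℚ + fromℕ n) k) (rise-vanishes n (ℕₚ.≤⇒≤′ n<k))) (*-zeroˡ (rise (1ℚ + fromℕ n) k))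

-- The total is the value at t = 1 of Pₙ(1 - 2t), that is Pₙ(-1).
legendre-sum : ∀ n M → n < M → ∑[ k < M ] legendre (fromℕ n) k ≡ (- 1ℚ) ^ n
legendre-sum zero    (suc M) n<M = trans
  (cong (λ r → 1ℚ + r) (∑-zero M (λ k → legendre (fromℕ 0) (suc k)) (λ k _ → legendre-vanishes 0 {suc k} z<s))) (+-identityʳ 1ℚ)
legendre-sum (suc n) (suc M) (s<s n<M) = alg
  (∑[ k < suc M ] legendre (fromℕ (suc n)) k) (∑[ k < suc M ] legendre (fromℕ n) k) ((- 1ℚ) ^ n)
  (cancel-suc n total) (legendre-sum n (suc M) (ℕₚ.m<n⇒m<1+n n<M))
  where
  alg : ∀ S S′ e → S + S′ ≡ 0ℚ → S′ ≡ e → S ≡ - 1ℚ * e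
  alg S S′ e h h′ = linear (1ℚ · h ⊞ - 1ℚ · h′) (solve (S ∷ S′ ∷ e ∷ []) ring)
  total : (1ℚ + fromℕ n) *
    ((∑[ k < suc M ] legendre (fromℕ (suc n)) k) + (∑[ k < suc M ] legendre (fromℕ n) k)) ≡ 0ℚ
  total = begin
    (1ℚ + fromℕ n) *
      ((∑[ k < suc M ] legendre (fromℕ (suc n)) k) + (∑[ k < suc M ] legendre (fromℕ n) k))
      ≡⟨ cong ((1ℚ + fromℕ n) *_) (∑-+ (suc M) (legendre (fromℕ (suc n))) (legendre (fromℕ n))) ⟨
    (1ℚ + fromℕ n) * (∑[ k < suc M ] (legendre (fromℕ (suc n)) k + legendre (fromℕ n) k))
      ≡⟨ cong (λ m → (1ℚ + fromℕ n) * (∑[ k < suc M ] (legendre m k + legendre (fromℕ n) k)))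
              (fromℕ-suc n) ⟩
    (1ℚ + fromℕ n) * (∑[ k < suc M ] (legendre (1ℚ + fromℕ n) k + legendre (fromℕ n) k))
      ≡⟨ legendre-partial-sums (fromℕ n) M ⟩
    2ℚ * (1ℚ + fromℕ n + fromℕ M) * legendre (fromℕ n) M
      ≡⟨ cong (2ℚ * (1ℚ + fromℕ n + fromℕ M) *_) (legendre-vanishes n n<M) ⟩
    2ℚ * (1ℚ + fromℕ n + fromℕ M) * 0ℚ
      ≡⟨ *-zeroʳ (2ℚ * (1ℚ + fromℕ n + fromℕ M)) ⟩
    0ℚ ∎
    where open ≡-Reasoning

sign² : ∀ n → (- 1ℚ) ^ n * (- 1ℚ) ^ n ≡ 1ℚ
sign² zero    = refl
sign² (suc n) = trans (alg ((- 1ℚ) ^ n)) (sign² n)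
  where
  alg : ∀ e → - 1ℚ * e * (- 1ℚ * e) ≡ e * e
  alg = solve-∀ ring

-- The reflection formula.

Φₙ : ℕ → ℚ → ℚ
Φₙ n = Φ (- fromℕ n) (1ℚ + fromℕ n) (suc n)

Φₙ-at-0 : ∀ n → Φₙ n 0ℚ ≡ 1ℚ
Φₙ-at-0 n = trans
  (cong (λ r → 1ℚ + r) (∑-zero n (λ k → legendre (fromℕ n) (suc k) * rise 0ℚ (suc k))
    (λ k _ → trans (cong (legendre (fromℕ n) (suc k) *_) (rise-0 k))
                                         (*-zeroʳ (legendre (fromℕ n) (suc k))))))
  (+-identityʳ 1ℚ)

Φₙ-at-1 : ∀ n → Φₙ n 1ℚ ≡ (- 1ℚ) ^ n
Φₙ-at-1 n = trans
  (∑-cong (suc n) (λ k → legendre (fromℕ n) k * rise 1ℚ k) (legendre (fromℕ n))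
    (λ k _ → trans (cong (legendre (fromℕ n) k *_) (rise-1 k)) (*-identityʳ (legendre (fromℕ n) k))))
  (legendre-sum n (suc n) (ℕₚ.n<1+n n))

-- The boundary term left by the telescoping contains `legendre n (n + 1)`, which is zero.
Φₙ-difference : ∀ n w →
  w * w * (Φₙ n w - Φₙ n (w + 1ℚ)) + (w + 1ℚ) * (w + 1ℚ) * (Φₙ n (w + 1ℚ + 1ℚ) - Φₙ n (w + 1ℚ))
  + - fromℕ n * (1ℚ + fromℕ n) * Φₙ n (w + 1ℚ) ≡ 0ℚ
Φₙ-difference n w = trans
  (Φ-difference (- fromℕ n) (1ℚ + fromℕ n) n w (sum≡1 (fromℕ n)))
  (trans (cong (λ c → (1ℚ + fromℕ n) * (1ℚ + fromℕ n) * c * rise (w + 1ℚ) n)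
               (legendre-vanishes n (ℕₚ.n<1+n n)))
         (alg (1ℚ + fromℕ n) (rise (w + 1ℚ) n)))
  where
  sum≡1 : ∀ m → - m + (1ℚ + m) ≡ 1ℚ
  sum≡1 = solve-∀ ring
  alg : ∀ x r → x * x * 0ℚ * r ≡ 0ℚ
  alg = solve-∀ ring

-- Both sides satisfy Φₙ-difference, which is invariant under z ↦ 1 - z, and agree at x = 0.
Φₙ-reflection : ∀ n x → Φₙ n (- fromℕ x) ≡ (- 1ℚ) ^ n * Φₙ n (1ℚ + fromℕ x)
Φₙ-reflection n x = proj₁ (go x)
  where
  ε = (- 1ℚ) ^ n
  F = Φₙ n
  κ = - fromℕ n * (1ℚ + fromℕ n)
  -- A second order recurrence needs two preceding values. The second component is the reflection at
  -- x - 1 weighted by x²; the weight makes it trivial at x = 0, so a single initial value suffices.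
  go : ∀ x → F (- fromℕ x) ≡ ε * F (1ℚ + fromℕ x)
           × fromℕ x * fromℕ x * (F (- fromℕ x + 1ℚ) - ε * F (fromℕ x)) ≡ 0ℚ
  go zero = trans (Φₙ-at-0 n) (sym (trans (cong (ε *_) (Φₙ-at-1 n)) (sign² n))) ,
            *-zeroˡ (F (- fromℕ 0 + 1ℚ) - ε * F (fromℕ 0))
  go (suc x) = x-y≡0⇒x≡y (cancel-suc x (cancel-suc x next)) , prev
    where
    X = fromℕ x
    down : - fromℕ (suc x) + 1ℚ ≡ - X
    down = trans (cong (λ m → - m + 1ℚ) (fromℕ-suc x)) (-[1+m]+1≡-m X)
    -- `E₁` relates the nodes -(x+1), -x, 1-x and `E₂` the nodes x, x+1, x+2; the map z ↦ 1 - z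
    -- exchanges the two triples.
    E₁ : - fromℕ (suc x) * - fromℕ (suc x) * (F (- fromℕ (suc x)) - F (- X))
         + - X * - X * (F (- X + 1ℚ) - F (- X)) + κ * F (- X) ≡ 0ℚ
    E₁ = subst
      (λ m → - fromℕ (suc x) * - fromℕ (suc x) * (F (- fromℕ (suc x)) - F m)
             + m * m * (F (m + 1ℚ) - F m) + κ * F m ≡ 0ℚ)
      down (Φₙ-difference n (- fromℕ (suc x)))
    E₂ : X * X * (F X - F (1ℚ + X)) + (1ℚ + X) * (1ℚ + X) * (F (1ℚ + fromℕ (suc x)) - F (1ℚ + X))
         + κ * F (1ℚ + X) ≡ 0ℚ
    E₂ = subst₂ (λ s t → X * X * (F X - F s) + s * s * (F t - F s) + κ * F s ≡ 0ℚ)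
      (+-comm X 1ℚ)
      (trans (+-comm (X + 1ℚ) 1ℚ) (cong (λ r → 1ℚ + r) (trans (+-comm X 1ℚ) (sym (fromℕ-suc x)))))
      (Φₙ-difference n X)
    next : (1ℚ + X) * ((1ℚ + X) * (F (- fromℕ (suc x)) - ε * F (1ℚ + fromℕ (suc x)))) ≡ 0ℚ
    next = alg X (fromℕ (suc x)) ε κ (F (- fromℕ (suc x))) (F (- X)) (F (- X + 1ℚ))
      (F X) (F (1ℚ + X)) (F (1ℚ + fromℕ (suc x)))
      E₁ E₂ (proj₁ (go x)) (proj₂ (go x)) (fromℕ-suc x)
      where
      alg : ∀ X s ε κ f₀ f₁ f₂ g₀ g₁ g₂ →
        - s * - s * (f₀ - f₁) + - X * - X * (f₂ - f₁) + κ * f₁ ≡ 0ℚ →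
        X * X * (g₀ - g₁) + (1ℚ + X) * (1ℚ + X) * (g₂ - g₁) + κ * g₁ ≡ 0ℚ →
        f₁ ≡ ε * g₁ → X * X * (f₂ - ε * g₀) ≡ 0ℚ → s ≡ 1ℚ + X →
        (1ℚ + X) * ((1ℚ + X) * (f₀ - ε * g₂)) ≡ 0ℚ
      alg X s ε κ f₀ f₁ f₂ g₀ g₁ g₂ h₁ h₂ h₃ h₄ h₅ = linear
        (1ℚ · h₁ ⊞ - ε · h₂ ⊞ (1ℚ + X) * (1ℚ + X) + X * X - κ · h₃ ⊞ - 1ℚ · h₄
         ⊞ - (s + (1ℚ + X)) * (f₀ - f₁) · h₅)
        (solve (X ∷ s ∷ ε ∷ κ ∷ f₀ ∷ f₁ ∷ f₂ ∷ g₀ ∷ g₁ ∷ g₂ ∷ []) ring)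
    prev : fromℕ (suc x) * fromℕ (suc x) * (F (- fromℕ (suc x) + 1ℚ) - ε * F (fromℕ (suc x))) ≡ 0ℚ
    prev = trans
      (cong₂ (λ s t → fromℕ (suc x) * fromℕ (suc x) * (F s - ε * F t)) down (fromℕ-suc x))
      (trans (cong (λ f → fromℕ (suc x) * fromℕ (suc x) * (f - ε * F (1ℚ + X))) (proj₁ (go x)))
             (alg (fromℕ (suc x)) (ε * F (1ℚ + X))))
      where
      alg : ∀ s t → s * s * (t - t) ≡ 0ℚ
      alg = solve-∀ ring

-- Orthogonality and the hockey stick identity

-- The moment of tʸ against the Legendre polynomial of degree m on [0,1], once N exceeds m. The
-- bound stays fixed while the degree varies in the recurrence.
cauchy : ℕ → ℕ → ℕ → ℚ
cauchy N m y = ∑[ k < N ] (legendre (fromℕ m) k * recip (y ℕ.+ k))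

-- In this combination the k-th terms lose the denominator y + k + 1 and become the sum of the
-- coefficients of degrees m + 1 and m. Their totals (-1)ᵐ⁺¹ and (-1)ᵐ cancel.
cauchy-step : ∀ N m y → suc m < N →
  (1ℚ + fromℕ (suc m ℕ.+ y)) * cauchy N (suc m) y ≡ (fromℕ m - fromℕ y) * cauchy N m y
cauchy-step N m y m<N = x-y≡0⇒x≡y (begin
  (1ℚ + fromℕ (suc m ℕ.+ y)) * cauchy N (suc m) y - (fromℕ m - fromℕ y) * cauchy N m y
    ≡⟨ alg₁ (1ℚ + fromℕ (suc m ℕ.+ y)) (cauchy N (suc m) y) (fromℕ m - fromℕ y) (cauchy N m y) ⟩
  (1ℚ + fromℕ (suc m ℕ.+ y)) * cauchy N (suc m) y + - (fromℕ m - fromℕ y) * cauchy N m y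
    ≡⟨ cong₂ _+_ (∑-*ˡ N (1ℚ + fromℕ (suc m ℕ.+ y)) (λ k → d′ k * i k))
                 (∑-*ˡ N (- (fromℕ m - fromℕ y)) (λ k → d k * i k)) ⟨
  (∑[ k < N ] ((1ℚ + fromℕ (suc m ℕ.+ y)) * (d′ k * i k)))
    + (∑[ k < N ] (- (fromℕ m - fromℕ y) * (d k * i k)))
    ≡⟨ ∑-+ N (λ k → (1ℚ + fromℕ (suc m ℕ.+ y)) * (d′ k * i k))
             (λ k → - (fromℕ m - fromℕ y) * (d k * i k)) ⟨
  ∑[ k < N ] ((1ℚ + fromℕ (suc m ℕ.+ y)) * (d′ k * i k) + - (fromℕ m - fromℕ y) * (d k * i k))
    ≡⟨ ∑-cong N (λ k → (1ℚ + fromℕ (suc m ℕ.+ y)) * (d′ k * i k) + - (fromℕ m - fromℕ y) * (d k * i k))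
              (λ k → d′ k + d k) (λ k _ → termwise k) ⟩
  ∑[ k < N ] (d′ k + d k)
    ≡⟨ ∑-+ N d′ d ⟩
  (∑[ k < N ] d′ k) + (∑[ k < N ] d k)
    ≡⟨ cong₂ _+_ (legendre-sum (suc m) N m<N) (legendre-sum m N (ℕₚ.<⇒≤ m<N)) ⟩
  - 1ℚ * (- 1ℚ) ^ m + (- 1ℚ) ^ m
    ≡⟨ alg₂ ((- 1ℚ) ^ m) ⟩
  0ℚ ∎)
  where
  open ≡-Reasoning
  d′ d i : ℕ → ℚ
  d′ = legendre (fromℕ (suc m))
  d  = legendre (fromℕ m)
  i k = recip (y ℕ.+ k)
  alg₁ : ∀ a b c d → a * b - c * d ≡ a * b + - c * d
  alg₁ = solve-∀ ring
  alg₂ : ∀ e → - 1ℚ * e + e ≡ 0ℚ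
  alg₂ = solve-∀ ring
  alg : ∀ m y k s sy yk i c c′ → s ≡ 1ℚ + m → sy ≡ s + y → yk ≡ y + k →
        (1ℚ + yk) * i ≡ 1ℚ → (1ℚ + m - k) * c′ ≡ (1ℚ + m + k) * c →
        (1ℚ + sy) * (c′ * i) + - (m - y) * (c * i) ≡ c′ + c
  alg m y k s sy yk i c c′ h₁ h₂ h₃ h₄ h₅ = linear
    (c′ * i · h₁ ⊞ c′ * i · h₂ ⊞ - ((c′ + c) * i) · h₃ ⊞ c′ + c · h₄ ⊞ i · h₅)
    (solve (m ∷ y ∷ k ∷ s ∷ sy ∷ yk ∷ i ∷ c ∷ c′ ∷ []) ring)
  termwise : ∀ k → (1ℚ + fromℕ (suc m ℕ.+ y)) * (d′ k * i k) + - (fromℕ m - fromℕ y) * (d k * i k)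
                   ≡ d′ k + d k
  termwise k = alg (fromℕ m) (fromℕ y) (fromℕ k) (fromℕ (suc m)) (fromℕ (suc m ℕ.+ y))
    (fromℕ (y ℕ.+ k)) (i k) (d k) (d′ k)
    (fromℕ-suc m) (fromℕ-+ (suc m) y) (fromℕ-+ y k) (recip-inverse (y ℕ.+ k))
    (trans (cong (λ s → (1ℚ + fromℕ m - fromℕ k) * legendre s k) (fromℕ-suc m))
           (legendre-step (fromℕ m) k))

-- Orthogonality to lower powers: the factor m - y of the recurrence vanishes at m = y, and the zero
-- propagates to all larger m.
cauchy-vanishes : ∀ N m y → y ℕ.<′ m → m < N → cauchy N m y ≡ 0ℚ
cauchy-vanishes N .(suc y) y ℕ.≤′-refl m<N = cancel-suc (suc y ℕ.+ y)
  (trans (cauchy-step N y y m<N) (alg (fromℕ y) (cauchy N y y)))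
  where
  alg : ∀ y c → (y - y) * c ≡ 0ℚ
  alg = solve-∀ ring
cauchy-vanishes N (suc m) y (ℕ.≤′-step y<m) m<N = cancel-suc (suc m ℕ.+ y)
  (trans (cauchy-step N m y m<N)
    (trans (cong ((fromℕ m - fromℕ y) *_) (cauchy-vanishes N m y y<m (ℕₚ.<⇒≤ m<N)))
           (*-zeroʳ (fromℕ m - fromℕ y))))

-- Iteration of `cauchy-step` from the moment 1/(y + 1) of the constant polynomial; the product of
-- denominators is kept on the left.
cauchy-value : ∀ N m y → m < N →
  (1ℚ + fromℕ (m ℕ.+ y)) * rise (1ℚ + fromℕ y) m * cauchy N m y ≡ rise (- fromℕ y) m
cauchy-value (suc N) zero y _ = trans
  (cong ((1ℚ + fromℕ y) * 1ℚ *_) (cong (λ r → 1ℚ * recip (y ℕ.+ 0) + r)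
    (∑-zero N (λ k → legendre (fromℕ 0) (suc k) * recip (y ℕ.+ suc k))
      (λ k _ → trans (cong (_* recip (y ℕ.+ suc k)) (legendre-vanishes 0 {suc k} z<s))
                     (*-zeroˡ (recip (y ℕ.+ suc k)))))))
  (alg (fromℕ y) (recip (y ℕ.+ 0)) (trans (cong (λ z → (1ℚ + fromℕ y) * recip z) (ℕₚ.+-identityʳ y)) (recip-inverse y)))
  where
  alg : ∀ y i → (1ℚ + y) * i ≡ 1ℚ → (1ℚ + y) * 1ℚ * (1ℚ * i + 0ℚ) ≡ 1ℚ
  alg y i h = linear (1ℚ · h) (solve (y ∷ i ∷ []) ring)
cauchy-value N (suc m) y m<N = alg (fromℕ m) (fromℕ y) (fromℕ (m ℕ.+ y)) (1ℚ + fromℕ (suc m ℕ.+ y)) (recip m)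
  (rise (1ℚ + fromℕ y) m) (rise (- fromℕ y) m) (cauchy N m y) (cauchy N (suc m) y)
  (cauchy-step N m y m<N) (cauchy-value N m y (ℕₚ.<⇒≤ m<N)) (fromℕ-+ m y)
  where
  alg : ∀ m y my t i r s c c′ → t * c′ ≡ (m - y) * c → (1ℚ + my) * r * c ≡ s → my ≡ m + y →
        t * (r * (1ℚ + y + m) * i) * c′ ≡ s * (- y + m) * i
  alg m y my t i r s c c′ h₁ h₂ h₃ = linear
    (r * (1ℚ + y + m) * i · h₁ ⊞ (m - y) * i · h₂ ⊞ - (r * c * (m - y) * i) · h₃)
    (solve (m ∷ y ∷ my ∷ t ∷ i ∷ r ∷ s ∷ c ∷ c′ ∷ []) ring)

rise-diagonal : ∀ n → rise (- fromℕ n) n ≡ (- 1ℚ) ^ n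
rise-diagonal zero    = refl
rise-diagonal (suc n) = alg (fromℕ n) (recip n) ((- 1ℚ) ^ n) (rise (- fromℕ n) n) (rise (- fromℕ (suc n)) (suc n))
  (recip-inverse n)
  (trans (cong (λ m → (1ℚ + fromℕ n) * rise (- m) (suc n)) (fromℕ-suc n)) (rise-lower-front (fromℕ n) n))
  (rise-diagonal n)
  where
  alg : ∀ n i e r r′ → (1ℚ + n) * i ≡ 1ℚ → (1ℚ + n) * r′ ≡ - (1ℚ + n) * r → r ≡ e → r′ ≡ - 1ℚ * e
  alg n i e r r′ h₁ h₂ h₃ = linear (- (r′ + r) · h₁ ⊞ i · h₂ ⊞ - 1ℚ · h₃) (solve (n ∷ i ∷ e ∷ r ∷ r′ ∷ []) ring)

-- The squared norm of the Legendre polynomial ∑ₖ legendre n k tᵏ on [0,1].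
legendre-norm : ∀ n → (1ℚ + fromℕ (n ℕ.+ n)) *
  (∑[ j < suc n ] (∑[ k < suc n ] (legendre (fromℕ n) j * legendre (fromℕ n) k * recip (j ℕ.+ k)))) ≡ 1ℚ
legendre-norm n = begin
  s * (∑[ j < suc n ] (∑[ k < suc n ] (d j * d k * recip (j ℕ.+ k))))
    ≡⟨ cong (s *_) (∑-cong (suc n) (λ j → ∑[ k < suc n ] (d j * d k * recip (j ℕ.+ k)))
         (λ j → d j * cauchy (suc n) n j)
         (λ j _ → trans (∑-cong (suc n) (λ k → d j * d k * recip (j ℕ.+ k)) (λ k → d j * (d k * recip (j ℕ.+ k)))
                           (λ k _ → *-assoc (d j) (d k) (recip (j ℕ.+ k))))
                        (∑-*ˡ (suc n) (d j) (λ k → d k * recip (j ℕ.+ k))))) ⟩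
  s * (∑[ j < suc n ] (d j * cauchy (suc n) n j))
    ≡⟨ cong (s *_) (∑-last n (λ j → d j * cauchy (suc n) n j)) ⟩
  s * ((∑[ j < n ] (d j * cauchy (suc n) n j)) + d n * cauchy (suc n) n n)
    ≡⟨ cong (λ S → s * (S + d n * cauchy (suc n) n n))
         (∑-zero n (λ j → d j * cauchy (suc n) n j)
           (λ j j<n → trans (cong (d j *_) (cauchy-vanishes (suc n) n j (ℕₚ.≤⇒≤′ j<n) (ℕₚ.n<1+n n)))
                            (*-zeroʳ (d j)))) ⟩
  s * (0ℚ + d n * cauchy (suc n) n n)
    -- Only the factor `rise (1 + n) n` of `d n` is absorbed by `cauchy-value`. The other factor
    -- then meets a copy of itself, and the square of a sign remains.
    ≡⟨ alg s (rise (- fromℕ n) n) (rise (1ℚ + fromℕ n) n) (cauchy (suc n) n n) ⟩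
  rise (- fromℕ n) n * (s * rise (1ℚ + fromℕ n) n * cauchy (suc n) n n)
    ≡⟨ cong (rise (- fromℕ n) n *_) (cauchy-value (suc n) n n (ℕₚ.n<1+n n)) ⟩
  rise (- fromℕ n) n * rise (- fromℕ n) n
    ≡⟨ cong (λ r → r * r) (rise-diagonal n) ⟩
  (- 1ℚ) ^ n * (- 1ℚ) ^ n
    ≡⟨ sign² n ⟩
  1ℚ ∎
  where
  open ≡-Reasoning
  s = 1ℚ + fromℕ (n ℕ.+ n)
  d = legendre (fromℕ n)
  alg : ∀ s r t c → s * (0ℚ + r * t * c) ≡ r * (s * t * c)
  alg = solve-∀ ring

-- The right side is a discrete antiderivative. By `rise-shift` its values at N and N + 1 are N - k
-- and N + 1 + j times the same product `rise (- N) k * rise (1 + N) j`, so they differ by 1 + j + k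
-- times the new summand.
rise-hockey-stick : ∀ j k N →
  (1ℚ + fromℕ (j ℕ.+ k)) * (∑[ x < N ] (rise (- fromℕ x) k * rise (1ℚ + fromℕ x) j))
  ≡ fromℕ N * (rise (1ℚ - fromℕ N) k * rise (1ℚ + fromℕ N) j)
rise-hockey-stick j k zero    = trans (*-zeroʳ (1ℚ + fromℕ (j ℕ.+ k))) (sym (*-zeroˡ (rise (1ℚ - 0ℚ) k * rise (1ℚ + 0ℚ) j)))
rise-hockey-stick j k (suc N)
  rewrite ∑-last N (λ x → rise (- fromℕ x) k * rise (1ℚ + fromℕ x) j)
  = alg (fromℕ j) (fromℕ k) (fromℕ (j ℕ.+ k)) (fromℕ N) (fromℕ (suc N))
      (∑[ x < N ] (rise (- fromℕ x) k * rise (1ℚ + fromℕ x) j))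
      (rise (1ℚ - fromℕ N) k) (rise (- fromℕ N) k) (rise (1ℚ - fromℕ (suc N)) k)
      (rise (1ℚ + fromℕ N) j) (rise (1ℚ + fromℕ (suc N)) j)
      (rise-hockey-stick j k N)
      (trans (cong (λ z → - fromℕ N * rise z k) (+-comm 1ℚ (- fromℕ N))) (rise-shift (- fromℕ N) k))
      (cong (λ z → rise z k) (trans (cong (λ m → 1ℚ - m) (fromℕ-suc N)) (eq (fromℕ N))))
      (trans (cong (λ m → (1ℚ + fromℕ N) * rise (1ℚ + m) j) (fromℕ-suc N)) (rise-upper (fromℕ N) j))
      (fromℕ-+ j k) (fromℕ-suc N)
  where
  eq : ∀ m → 1ℚ - (1ℚ + m) ≡ - m
  eq = solve-∀ ring
  alg : ∀ j k jk N N′ S a b c d e → (1ℚ + jk) * S ≡ N * (a * d) →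
        - N * a ≡ (- N + k) * b → c ≡ b → (1ℚ + N) * e ≡ (1ℚ + N + j) * d →
        jk ≡ j + k → N′ ≡ 1ℚ + N →
        (1ℚ + jk) * (S + b * d) ≡ N′ * (c * e)
  alg j k jk N N′ S a b c d e h₁ h₂ h₃ h₄ h₅ h₆ = linear
    (1ℚ · h₁ ⊞ - d · h₂ ⊞ - ((1ℚ + N) * e) · h₃ ⊞ - b · h₄ ⊞ b * d · h₅ ⊞ - (c * e) · h₆)
    (solve (j ∷ k ∷ jk ∷ N ∷ N′ ∷ S ∷ a ∷ b ∷ c ∷ d ∷ e ∷ []) ring)

-- p-integrality

*-↧≡↥ : ∀ x → x * fromℤ (↧ x) ≡ fromℤ (↥ x)
*-↧≡↥ x@(mkℚ n d _) = toℚᵘ-injective (ℚᵘₚ.≃-trans (toℚᵘ-homo-* x (fromℤ (↧ x)))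
  (ℚᵘ.*≡* (trans (ℤₚ.*-identityʳ (n ℤ.* + suc d))
                 (cong (λ m → n ℤ.* + m) (sym (ℕₚ.*-identityʳ (suc d)))))))

-- Writing x in lowest terms as n/e and clearing denominators shows that e divides n d, and e is
-- coprime to n.
denominator-∣ : ∀ d x z → fromℕ d * x ≡ fromℤ z → ↧ₙ x ∣ d
denominator-∣ d x@(mkℚ n e c) z eq = Coprimality.coprime-divisor
  (Coprimality.sym (Coprimality.recompute c)) (∣.divides ℤ.∣ z ∣ (begin
    ℤ.∣ n ∣ ℕ.* d           ≡⟨ ℕₚ.*-comm ℤ.∣ n ∣ d ⟩
    d ℕ.* ℤ.∣ n ∣           ≡⟨ ℤₚ.abs-* (+ d) n ⟨
    ℤ.∣ + d ℤ.* n ∣         ≡⟨ cong ℤ.∣_∣ (fromℤ-injective cleared) ⟩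
    ℤ.∣ z ℤ.* + suc e ∣     ≡⟨ ℤₚ.abs-* z (+ suc e) ⟩
    ℤ.∣ z ∣ ℕ.* suc e       ∎))
  where
  open ≡-Reasoning
  cleared : fromℤ (+ d ℤ.* n) ≡ fromℤ (z ℤ.* + suc e)
  cleared = begin
    fromℤ (+ d ℤ.* n)             ≡⟨ fromℤ-* (+ d) n ⟩
    fromℕ d * fromℤ n             ≡⟨ cong (fromℕ d *_) (*-↧≡↥ x) ⟨
    fromℕ d * (x * fromℤ (↧ x))   ≡⟨ *-assoc (fromℕ d) x (fromℤ (↧ x)) ⟨
    fromℕ d * x * fromℤ (↧ x)     ≡⟨ cong (_* fromℤ (↧ x)) eq ⟩
    fromℤ z * fromℤ (↧ x)         ≡⟨ fromℤ-* z (+ suc e) ⟨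
    fromℤ (z ℤ.* + suc e)         ∎

^-+ : ∀ x s t → x ^ (s ℕ.+ t) ≡ x ^ s * x ^ t
^-+ x zero    t = sym (*-identityˡ (x ^ t))
^-+ x (suc s) t = trans (cong (x *_) (^-+ x s t)) (sym (*-assoc x (x ^ s) (x ^ t)))

module Localisation (p : ℕ) (p-prime : Prime p) where

  -- Any denominator prime to p is accepted, not only the reduced one. Sums and products are then
  -- formed without cancelling common factors, and `denominator-∣` recovers the statement about the
  -- reduced denominator at the end.
  record Integral (x : ℚ) : Set where
    constructor integral
    field
      multiplier : ℕ
      numerator  : ℤ
      p∤         : p ∤ multiplier
      cleared    : fromℕ multiplier * x ≡ fromℤ numerator

  record Divisible (s : ℕ) (x : ℚ) : Set where
    constructor divisible
    field
      quotient : ℚ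
      isIntegral : Integral quotient
      factored : x ≡ fromℕ p ^ s * quotient

  Integral⇒coprime : ∀ {x} → Integral x → Coprime p (↧ₙ x)
  Integral⇒coprime {x} (integral d z p∤d eq) (i∣p , i∣x) with prime⇒irreducible p-prime i∣p
  ... | inj₁ i≡1  = i≡1
  ... | inj₂ refl = contradiction (∣.∣-trans i∣x (denominator-∣ d x z eq)) p∤d

  Divisible⇒mod : ∀ {s a b} → Divisible s (a - b) → a ≡ b [mod p ^ s ]
  Divisible⇒mod (divisible c i eq) = c , Integral⇒coprime i , eq

  p∤1 : p ∤ 1
  p∤1 p∣1 = ℕₚ.<-irrefl (sym (∣.∣1⇒≡1 p∣1)) (ℕ.nonTrivial⇒n>1 p {{prime⇒nonTrivial p-prime}})

  p∤* : ∀ {m n} → p ∤ m → p ∤ n → p ∤ m ℕ.* n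
  p∤* {m} {n} p∤m p∤n p∣mn with euclidsLemma m n p-prime p∣mn
  ... | inj₁ p∣m = p∤m p∣m
  ... | inj₂ p∣n = p∤n p∣n

  fromℤ-integral : ∀ z → Integral (fromℤ z)
  fromℤ-integral z = integral 1 z p∤1 (*-identityˡ (fromℤ z))

  fromℕ-integral : ∀ n → Integral (fromℕ n)
  fromℕ-integral n = fromℤ-integral (+ n)

  recip-integral : ∀ k → p ∤ suc k → Integral (recip k)
  recip-integral k p∤k = integral (suc k) 1ℤ p∤k (recip-inverse′ k)

  *-integral : ∀ {x y} → Integral x → Integral y → Integral (x * y)
  *-integral {x} {y} (integral d z p∤d eq) (integral e w p∤e eq′) = integral (d ℕ.* e) (z ℤ.* w) (p∤* p∤d p∤e)
    (trans (cong (_* (x * y)) (fromℕ-* d e)) (trans (alg (fromℕ d) (fromℕ e) x y)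
      (trans (cong₂ _*_ eq eq′) (sym (fromℤ-* z w)))))
    where
    alg : ∀ d e x y → d * e * (x * y) ≡ d * x * (e * y)
    alg = solve-∀ ring

  +-integral : ∀ {x y} → Integral x → Integral y → Integral (x + y)
  +-integral {x} {y} (integral d z p∤d eq) (integral e w p∤e eq′) =
    integral (d ℕ.* e) (z ℤ.* + e ℤ.+ + d ℤ.* w) (p∤* p∤d p∤e) (begin
      fromℕ (d ℕ.* e) * (x + y)                    ≡⟨ cong (_* (x + y)) (fromℕ-* d e) ⟩
      fromℕ d * fromℕ e * (x + y)                  ≡⟨ alg (fromℕ d) (fromℕ e) x y ⟩
      fromℕ d * x * fromℕ e + fromℕ d * (fromℕ e * y)
        ≡⟨ cong₂ (λ s t → s * fromℕ e + fromℕ d * t) eq eq′ ⟩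
      fromℤ z * fromℕ e + fromℕ d * fromℤ w        ≡⟨ cong₂ _+_ (fromℤ-* z (+ e)) (fromℤ-* (+ d) w) ⟨
      fromℤ (z ℤ.* + e) + fromℤ (+ d ℤ.* w)        ≡⟨ fromℤ-+ (z ℤ.* + e) (+ d ℤ.* w) ⟨
      fromℤ (z ℤ.* + e ℤ.+ + d ℤ.* w)              ∎)
    where
    open ≡-Reasoning
    alg : ∀ d e x y → d * e * (x + y) ≡ d * x * e + d * (e * y)
    alg = solve-∀ ring

  neg-integral : ∀ {x} → Integral x → Integral (- x)
  neg-integral {x} (integral d z p∤d eq) = integral d (ℤ.- z) p∤d
    (trans (sym (neg-distribʳ-* (fromℕ d) x)) (trans (cong -_ eq) (sym (fromℤ-neg z))))

  ∑-integral : ∀ N (f : ℕ → ℚ) → (∀ k → k < N → Integral (f k)) → Integral (∑[ k < N ] f k)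
  ∑-integral zero    f h = fromℤ-integral +0
  ∑-integral (suc N) f h = +-integral (h 0 z<s) (∑-integral N (f ∘ suc) (λ k → h (suc k) ∘ s<s))

  -- With these precedences a divisibility proof reads as an identity, then `_∵_`, then a sum of
  -- terms each of the form integral `⊙` divisible.
  infixr 2 _∵_

  _∵_ : ∀ {s x y} → x ≡ y → Divisible s y → Divisible s x
  eq ∵ d = subst (Divisible _) (sym eq) d

  infixl 4 _⊕_
  infixr 5 _⊙_

  _⊕_ : ∀ {s x y} → Divisible s x → Divisible s y → Divisible s (x + y)
  _⊕_ {s} (divisible c i eq) (divisible c′ i′ eq′) = divisible (c + c′) (+-integral i i′)
    (trans (cong₂ _+_ eq eq′) (sym (*-distribˡ-+ (fromℕ p ^ s) c c′)))

  _⊙_ : ∀ {s x y} → Integral x → Divisible s y → Divisible s (x * y)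
  _⊙_ {s} {x} i (divisible c i′ eq) = divisible (x * c) (*-integral i i′)
    (trans (cong (x *_) eq) (alg x (fromℕ p ^ s) c))
    where
    alg : ∀ x p c → x * (p * c) ≡ p * (x * c)
    alg = solve-∀ ring

  *-divisible : ∀ {s t x y} → Divisible s x → Divisible t y → Divisible (s ℕ.+ t) (x * y)
  *-divisible {s} {t} (divisible c i eq) (divisible c′ i′ eq′) = divisible (c * c′) (*-integral i i′)
    (trans (cong₂ _*_ eq eq′) (trans (alg (fromℕ p ^ s) (fromℕ p ^ t) c c′)
      (cong (_* (c * c′)) (sym (^-+ (fromℕ p) s t)))))
    where
    alg : ∀ x y c c′ → x * c * (y * c′) ≡ x * y * (c * c′)
    alg = solve-∀ ring

  neg-divisible : ∀ {s x} → Divisible s x → Divisible s (- x)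
  neg-divisible {s} (divisible c i eq) = divisible (- c) (neg-integral i)
    (trans (cong -_ eq) (neg-distribʳ-* (fromℕ p ^ s) c))

  p-divisible : Divisible 1 (fromℕ p)
  p-divisible = divisible 1ℚ (fromℤ-integral 1ℤ)
    (sym (trans (*-identityʳ (fromℕ p * 1ℚ)) (*-identityʳ (fromℕ p))))

  p²-divisible : Divisible 2 (fromℕ p * fromℕ p)
  p²-divisible = *-divisible p-divisible p-divisible

  0-divisible : ∀ {s} → Divisible s 0ℚ
  0-divisible {s} = divisible 0ℚ (fromℤ-integral +0) (sym (*-zeroʳ (fromℕ p ^ s)))

  divisible-pred : ∀ {s x} → Divisible (suc s) x → Divisible s x
  divisible-pred {s} (divisible c i eq) = divisible (fromℕ p * c) (*-integral (fromℕ-integral p) i)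
    (trans eq (alg (fromℕ p) (fromℕ p ^ s) c))
    where
    alg : ∀ p q c → p * q * c ≡ q * (p * c)
    alg = solve-∀ ring

  ∑-divisible : ∀ {s} N (f : ℕ → ℚ) → (∀ k → k < N → Divisible s (f k)) → Divisible s (∑[ k < N ] f k)
  ∑-divisible zero    f h = 0-divisible
  ∑-divisible (suc N) f h = h 0 z<s ⊕ ∑-divisible N (f ∘ suc) (λ k → h (suc k) ∘ s<s)

-- Harmonic sums modulo p

∑-even-odd : ∀ n (f : ℕ → ℚ) →
  ∑[ i < n ℕ.+ n ] f i ≡ (∑[ i < n ] f (i ℕ.+ i)) + (∑[ i < n ] f (suc (i ℕ.+ i)))
∑-even-odd zero    f = refl
∑-even-odd (suc n) f = begin
  ∑[ i < suc n ℕ.+ suc n ] f i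
    ≡⟨ cong (λ m → ∑[ i < suc m ] f i) (ℕₚ.+-suc n n) ⟩
  ∑[ i < suc (suc (n ℕ.+ n)) ] f i
    ≡⟨ ∑-last (suc (n ℕ.+ n)) f ⟩
  (∑[ i < suc (n ℕ.+ n) ] f i) + f (suc (n ℕ.+ n))
    ≡⟨ cong (_+ f (suc (n ℕ.+ n))) (trans (∑-last (n ℕ.+ n) f) (cong (_+ f (n ℕ.+ n)) (∑-even-odd n f))) ⟩
  E + O + f (n ℕ.+ n) + f (suc (n ℕ.+ n))
    ≡⟨ alg E O (f (n ℕ.+ n)) (f (suc (n ℕ.+ n))) ⟩
  E + f (n ℕ.+ n) + (O + f (suc (n ℕ.+ n)))
    ≡⟨ cong₂ _+_ (∑-last n (λ i → f (i ℕ.+ i))) (∑-last n (λ i → f (suc (i ℕ.+ i)))) ⟨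
  (∑[ i < suc n ] f (i ℕ.+ i)) + (∑[ i < suc n ] f (suc (i ℕ.+ i))) ∎
  where
  open ≡-Reasoning
  E O : ℚ
  E = ∑[ i < n ] f (i ℕ.+ i)
  O = ∑[ i < n ] f (suc (i ℕ.+ i))
  alg : ∀ a b c d → a + b + c + d ≡ a + c + (b + d)
  alg = solve-∀ ring

∑-split : ∀ m n (f : ℕ → ℚ) → ∑[ i < m ℕ.+ n ] f i ≡ (∑[ i < m ] f i) + (∑[ i < n ] f (m ℕ.+ i))
∑-split zero    n f = sym (+-identityˡ _)
∑-split (suc m) n f = trans (cong (λ r → f 0 + r) (∑-split m n (f ∘ suc)))
  (sym (+-assoc (f 0) (∑[ i < m ] f (suc i)) (∑[ i < n ] f (suc m ℕ.+ i))))

recip² : ℕ → ℚ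
recip² i = recip i * recip i

fromℕ-double : ∀ i → fromℕ (i ℕ.+ i) ≡ 2ℚ * fromℕ i
fromℕ-double i = trans (fromℕ-+ i i) (alg (fromℕ i))
  where
  alg : ∀ x → x + x ≡ 2ℚ * x
  alg = solve-∀ ring

recip²-double : ∀ i → recip² (suc (i ℕ.+ i)) ≡ ½ * ½ * recip² i
recip²-double i = trans (cong (λ r → r * r) half) (alg (recip i))
  where
  alg : ∀ r → ½ * r * (½ * r) ≡ ½ * ½ * (r * r)
  alg = solve-∀ ring
  alg′ : ∀ i r s t u → (1ℚ + i) * r ≡ 1ℚ → (1ℚ + s) * t ≡ 1ℚ → s ≡ 1ℚ + u → u ≡ 2ℚ * i → t ≡ ½ * r
  alg′ i r s t u h₁ h₂ h₃ h₄ = linear (- t · h₁ ⊞ ½ * r · h₂ ⊞ - (½ * r * t) · h₃ ⊞ - (½ * r * t) · h₄)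
    (solve (i ∷ r ∷ s ∷ t ∷ u ∷ []) ring)
  half : recip (suc (i ℕ.+ i)) ≡ ½ * recip i
  half = alg′ (fromℕ i) (recip i) (fromℕ (suc (i ℕ.+ i))) (recip (suc (i ℕ.+ i))) (fromℕ (i ℕ.+ i))
    (recip-inverse i) (recip-inverse (suc (i ℕ.+ i))) (fromℕ-suc (i ℕ.+ i)) (fromℕ-double i)

module OddPrime (n : ℕ) (p-prime : Prime (suc (n ℕ.+ n))) where

  p : ℕ
  p = suc (n ℕ.+ n)

  P : ℚ
  P = fromℕ p

  open Localisation p p-prime public

  P≡1+2n : P ≡ 1ℚ + 2ℚ * fromℕ n
  P≡1+2n = trans (fromℕ-suc (n ℕ.+ n)) (cong (λ x → 1ℚ + x) (fromℕ-double n))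

  p∤small : ∀ {k} → k < n ℕ.+ n → p ∤ suc k
  p∤small k<2n = ∣.>⇒∤ (s<s k<2n)

  recip-small : ∀ {k} → k < n ℕ.+ n → Integral (recip k)
  recip-small {k} k<2n = recip-integral k (p∤small k<2n)

  ½-integral : 1 < n ℕ.+ n → Integral ½
  ½-integral = recip-small {1}

  rise-integral : ∀ {z} k → Integral z → k ≤ n ℕ.+ n → Integral (rise z k)
  rise-integral zero    iz k≤2n = fromℤ-integral 1ℤ
  rise-integral (suc k) iz k≤2n = *-integral
    (*-integral (rise-integral k iz (ℕₚ.<⇒≤ k≤2n)) (+-integral iz (fromℕ-integral k)))
    (recip-small k≤2n)

  -- The hypothesis says that the actual denominators a + 1 and b + 1 add up to p; hence 1/(a+1) +
  -- 1/(b+1) is p divided by their product.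
  recip-reflect : ∀ a b → suc (a ℕ.+ b) ≡ n ℕ.+ n → Divisible 1 (recip a + recip b)
  recip-reflect a b eq =
    alg (fromℕ a) (fromℕ b) (recip a) (recip b) P (recip-inverse a) (recip-inverse b)
      (trans (cong (λ m → fromℕ (suc m)) (sym eq))
        (trans (fromℕ-suc (suc (a ℕ.+ b))) (cong (λ r → 1ℚ + r)
          (trans (fromℕ-suc (a ℕ.+ b)) (cong (λ r → 1ℚ + r) (fromℕ-+ a b))))))
    ∵ *-integral (recip-small {a} (subst (a <_) eq (s≤s (ℕₚ.m≤m+n a b))))
                 (recip-small {b} (subst (b <_) eq (s≤s (ℕₚ.m≤n+m b a))))
      ⊙ p-divisible
    where
    alg : ∀ a b i j p → (1ℚ + a) * i ≡ 1ℚ → (1ℚ + b) * j ≡ 1ℚ → p ≡ 1ℚ + (1ℚ + (a + b)) →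
          i + j ≡ i * j * p
    alg a b i j p h₁ h₂ h₃ = linear (- j · h₁ ⊞ - i · h₂ ⊞ - (i * j) · h₃)
      (solve (a ∷ b ∷ i ∷ j ∷ p ∷ []) ring)

  recip²-reflect : ∀ a b → suc (a ℕ.+ b) ≡ n ℕ.+ n → Divisible 1 (recip² a - recip² b)
  recip²-reflect a b eq = alg (recip a) (recip b)
    ∵ +-integral (recip-small {a} (subst (a <_) eq (s≤s (ℕₚ.m≤m+n a b))))
                 (neg-integral (recip-small {b} (subst (b <_) eq (s≤s (ℕₚ.m≤n+m b a)))))
      ⊙ recip-reflect a b eq
    where
    alg : ∀ i j → i * i - j * j ≡ (i - j) * (i + j)
    alg = solve-∀ ring

  ∑-congruent : ∀ N (f g : ℕ → ℚ) → (∀ k → k < N → Divisible 1 (f k - g k)) →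
                Divisible 1 ((∑[ k < N ] f k) - (∑[ k < N ] g k))
  ∑-congruent zero    f g h = 0-divisible
  ∑-congruent (suc N) f g h =
    alg (f 0) (g 0) (∑[ k < N ] f (suc k)) (∑[ k < N ] g (suc k))
    ∵ h 0 z<s ⊕ ∑-congruent N (f ∘ suc) (g ∘ suc) (λ k → h (suc k) ∘ s<s)
    where
    alg : ∀ a b c d → a + c - (b + d) ≡ (a - b) + (c - d)
    alg = solve-∀ ring

  H A : ℕ → ℚ
  H k = ∑[ i < k ] recip i
  A k = ∑[ i < k ] recip² i

  -- Because of the shift in `recip`, the index i + i stands for the odd number 2i + 1.
  O : ℕ → ℚ
  O k = ∑[ i < k ] recip² (i ℕ.+ i)

  full≡O+A/4 : A (n ℕ.+ n) ≡ O n + ½ * ½ * A n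
  full≡O+A/4 = trans (∑-even-odd n recip²) (cong (λ r → O n + r)
    (trans (∑-cong n (λ i → recip² (suc (i ℕ.+ i))) (λ i → ½ * ½ * recip² i) (λ i _ → recip²-double i))
           (∑-*ˡ n (½ * ½) recip²)))

  reverse-index : ∀ {i} → i < n → n ∸ suc i ℕ.+ suc i ≡ n
  reverse-index = ℕₚ.m∸n+n≡m

  -- The reflection t ↦ p - t carries the upper half of 0 < t < p to the lower half and preserves
  -- 1/t² modulo p.
  full≡2A : Divisible 1 (A (n ℕ.+ n) - 2ℚ * A n)
  full≡2A =
    trans (cong (λ s → s - 2ℚ * A n) (trans (∑-split n n recip²)
            (cong (λ r → A n + r) (∑-reverse n (λ i → recip² (n ℕ.+ i))))))
          (alg (A n) (∑[ i < n ] recip² (n ℕ.+ (n ∸ suc i))))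
    ∵ ∑-congruent n (λ i → recip² (n ℕ.+ (n ∸ suc i))) recip²
        (λ i i<n → recip²-reflect (n ℕ.+ (n ∸ suc i)) i (trans (sym (ℕₚ.+-suc _ i))
          (trans (ℕₚ.+-assoc n (n ∸ suc i) (suc i)) (cong (n ℕ.+_) (reverse-index i<n)))))
    where
    alg : ∀ a b → a + b - 2ℚ * a ≡ b - a
    alg = solve-∀ ring

  -- Since p is odd, t ↦ p - t exchanges odd and even numbers; the even ones contribute 1/(2i+2)².
  O≡A/4 : Divisible 1 (O n - ½ * ½ * A n)
  O≡A/4 = cong₂ _-_ (∑-reverse n (λ i → recip² (i ℕ.+ i))) (sym (∑-*ˡ n (½ * ½) recip²))
    ∵ ∑-congruent n (λ i → recip² ((n ∸ suc i) ℕ.+ (n ∸ suc i))) (λ i → ½ * ½ * recip² i)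
        (λ i i<n → cong (λ r → recip² ((n ∸ suc i) ℕ.+ (n ∸ suc i)) - r) (sym (recip²-double i))
          ∵ recip²-reflect ((n ∸ suc i) ℕ.+ (n ∸ suc i)) (suc (i ℕ.+ i))
              (index (n ∸ suc i) i (reverse-index i<n)))
    where
    open ≡-Reasoning
    index : ∀ m i → m ℕ.+ suc i ≡ n → suc (m ℕ.+ m ℕ.+ suc (i ℕ.+ i)) ≡ n ℕ.+ n
    index m i refl = begin
      suc (m ℕ.+ m ℕ.+ suc (i ℕ.+ i))   ≡⟨ ℕₚ.+-suc (m ℕ.+ m) (suc (i ℕ.+ i)) ⟨
      m ℕ.+ m ℕ.+ suc (suc (i ℕ.+ i))   ≡⟨ cong (λ r → m ℕ.+ m ℕ.+ suc r) (ℕₚ.+-suc i i) ⟨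
      m ℕ.+ m ℕ.+ (suc i ℕ.+ suc i)     ≡⟨ ℕₚ.+-assoc m m (suc i ℕ.+ suc i) ⟩
      m ℕ.+ (m ℕ.+ (suc i ℕ.+ suc i))   ≡⟨ cong (m ℕ.+_) (ℕₚ.+-assoc m (suc i) (suc i)) ⟨
      m ℕ.+ (m ℕ.+ suc i ℕ.+ suc i)     ≡⟨ cong (m ℕ.+_) (ℕₚ.+-comm (m ℕ.+ suc i) (suc i)) ⟩
      m ℕ.+ (suc i ℕ.+ (m ℕ.+ suc i))   ≡⟨ ℕₚ.+-assoc m (suc i) (m ℕ.+ suc i) ⟨
      m ℕ.+ suc i ℕ.+ (m ℕ.+ suc i)     ∎

  -- The full sum is congruent both to twice `A n` and, split by parity, to `A n`/4 + `A n`/4. Hence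
  -- 3/2 times `A n` vanishes modulo p, and 2/3 is p-integral for p > 3.
  A-divisible : 2 < n ℕ.+ n → Divisible 1 (A n)
  A-divisible 2<2n = alg (A n) (A (n ℕ.+ n)) (O n) (recip 2) full≡O+A/4 (recip-inverse 2)
    ∵ *-integral (fromℕ-integral 2) (recip-small 2<2n) ⊙ (O≡A/4 ⊕ neg-divisible full≡2A)
    where
    alg : ∀ a f o t → f ≡ o + ½ * ½ * a → (1ℚ + fromℕ 2) * t ≡ 1ℚ →
          a ≡ fromℕ 2 * t * ((o - ½ * ½ * a) + - (f - 2ℚ * a))
    alg a f o t h₁ h₂ = linear (fromℕ 2 * t · h₁ ⊞ - a · h₂) (solve (a ∷ f ∷ o ∷ t ∷ []) ring)

  -- Products of 1 + q/i modulo p² and p³.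

  H-integral : ∀ k → k ≤ n ℕ.+ n → Integral (H k)
  H-integral k k≤2n = ∑-integral k recip (λ i i<k → recip-small (ℕₚ.<-≤-trans i<k k≤2n))

  -- `rise (1 + q) k` is the product of 1 + q/i over 1 ≤ i ≤ k, expanded here to first order. A
  -- general q covers both p and -p.
  rise-mod-p² : ∀ q k → Divisible 1 q → k ≤ n ℕ.+ n → Divisible 2 (rise (1ℚ + q) k - (1ℚ + q * H k))
  rise-mod-p² q zero    q∈p k≤2n = alg q ∵ 0-divisible
    where
    alg : ∀ q → 1ℚ - (1ℚ + q * 0ℚ) ≡ 0ℚ
    alg = solve-∀ ring
  rise-mod-p² q (suc k) q∈p k<2n =
    alg q (fromℕ k) (recip k) (rise (1ℚ + q) k) (H k) (H (suc k)) (∑-last k recip) (recip-inverse k)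
    ∵ +-integral (fromℤ-integral 1ℤ) (*-integral q-integral (recip-small k<2n))
        ⊙ rise-mod-p² q k q∈p (ℕₚ.<⇒≤ k<2n)
      ⊕ *-integral (H-integral k (ℕₚ.<⇒≤ k<2n)) (recip-small k<2n) ⊙ *-divisible q∈p q∈p
    where
    q-integral : Integral q
    q-integral = subst Integral (sym (trans (Divisible.factored q∈p) (cong (_* Divisible.quotient q∈p) (*-identityʳ P))))
                   (*-integral (fromℕ-integral p) (Divisible.isIntegral q∈p))
    alg : ∀ q k i r h h′ → h′ ≡ h + i → (1ℚ + k) * i ≡ 1ℚ →
          r * (1ℚ + q + k) * i - (1ℚ + q * h′) ≡ (1ℚ + q * i) * (r - (1ℚ + q * h)) + h * i * (q * q)
    alg q k i r h h′ e₁ e₂ = linear (- q · e₁ ⊞ r · e₂) (solve (q ∷ k ∷ i ∷ r ∷ h ∷ h′ ∷ []) ring)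

  A-integral : ∀ k → k ≤ n ℕ.+ n → Integral (A k)
  A-integral k k≤2n = ∑-integral k recip²
    (λ i i<k → *-integral (recip-small (ℕₚ.<-≤-trans i<k k≤2n)) (recip-small (ℕₚ.<-≤-trans i<k k≤2n)))

  -- The product is that of 1 - p²/i² over 1 ≤ i ≤ k, in which all mixed terms are divisible by p⁴.
  rise-product-mod-p³ : ∀ k → k ≤ n ℕ.+ n →
    Divisible 3 (rise (1ℚ + P) k * rise (1ℚ - P) k - (1ℚ - P * P * A k))
  rise-product-mod-p³ zero    k≤2n = alg P ∵ 0-divisible
    where
    alg : ∀ p → 1ℚ * 1ℚ - (1ℚ - p * p * 0ℚ) ≡ 0ℚ
    alg = solve-∀ ring
  rise-product-mod-p³ (suc k) k<2n =
    alg P (fromℕ k) (recip k) (rise (1ℚ + P) k) (rise (1ℚ - P) k) (A k) (A (suc k)) (∑-last k recip²) (recip-inverse k)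
    ∵ +-integral (fromℤ-integral 1ℤ) (neg-integral (*-integral (*-integral (fromℕ-integral p) (fromℕ-integral p))
          (*-integral (recip-small k<2n) (recip-small k<2n))))
        ⊙ rise-product-mod-p³ k (ℕₚ.<⇒≤ k<2n)
      ⊕ *-integral (fromℕ-integral p) (*-integral (A-integral k (ℕₚ.<⇒≤ k<2n)) (*-integral (recip-small k<2n) (recip-small k<2n)))
        ⊙ *-divisible p-divisible p²-divisible
    where
    alg : ∀ p k i u v a a′ → a′ ≡ a + i * i → (1ℚ + k) * i ≡ 1ℚ →
          u * (1ℚ + p + k) * i * (v * (1ℚ - p + k) * i) - (1ℚ - p * p * a′)
          ≡ (1ℚ - p * p * (i * i)) * (u * v - (1ℚ - p * p * a)) + p * (a * (i * i)) * (p * (p * p))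
    alg p k i u v a a′ e₁ e₂ = linear (p * p · e₁ ⊞ u * v * (1ℚ + (1ℚ + k) * i) · e₂)
      (solve (p ∷ k ∷ i ∷ u ∷ v ∷ a ∷ a′ ∷ []) ring)

  -- The terms of order p cancel after symmetrisation.
  rise-symmetrised-mod-p² : ∀ j k → j ≤ n ℕ.+ n → k ≤ n ℕ.+ n →
    Divisible 2 (rise (1ℚ + P) j * rise (1ℚ - P) k + rise (1ℚ + P) k * rise (1ℚ - P) j - 2ℚ)
  rise-symmetrised-mod-p² j k j≤2n k≤2n =
    alg P (H j) (H k) (rise (1ℚ + P) j) (rise (1ℚ + P) k) (rise (1ℚ - P) j) (rise (1ℚ - P) k)
    ∵ rise-integral k 1-P-integral k≤2n ⊙ rise-mod-p² P j p-divisible j≤2n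
      ⊕ rise-integral j 1-P-integral j≤2n ⊙ rise-mod-p² P k p-divisible k≤2n
      ⊕ 1+pH j j≤2n ⊙ rise-mod-p² (- P) k (neg-divisible p-divisible) k≤2n
      ⊕ 1+pH k k≤2n ⊙ rise-mod-p² (- P) j (neg-divisible p-divisible) j≤2n
      -- The first order approximations leave (1 + pa)(1 - pb) + (1 + pb)(1 - pa) - 2 = -2p²ab.
      ⊕ *-integral (neg-integral (fromℕ-integral 2)) (*-integral (H-integral j j≤2n) (H-integral k k≤2n)) ⊙ p²-divisible
    where
    1-P-integral : Integral (1ℚ - P)
    1-P-integral = +-integral (fromℤ-integral 1ℤ) (neg-integral (fromℕ-integral p))
    1+pH : ∀ j → j ≤ n ℕ.+ n → Integral (1ℚ + P * H j)
    1+pH j j≤2n = +-integral (fromℤ-integral 1ℤ) (*-integral (fromℕ-integral p) (H-integral j j≤2n))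
    alg : ∀ p a b u u′ v v′ → u * v′ + u′ * v - 2ℚ ≡
      v′ * (u - (1ℚ + p * a)) + v * (u′ - (1ℚ + p * b))
      + (1ℚ + p * a) * (v′ - (1ℚ + - p * b)) + (1ℚ + p * b) * (v - (1ℚ + - p * a))
      + - fromℕ 2 * (a * b) * (p * p)
    alg = solve-∀ ring

-- The parameters (1 ∓ p)/2

∑∑ : ℕ → ℕ → (ℕ → ℕ → ℚ) → ℚ
∑∑ M N f = ∑[ j < M ] (∑[ k < N ] f j k)

∑∑-cong : ∀ M N (f g : ℕ → ℕ → ℚ) → (∀ j k → j < M → k < N → f j k ≡ g j k) → ∑∑ M N f ≡ ∑∑ M N g
∑∑-cong M N f g h = ∑-cong M (λ j → ∑[ k < N ] f j k) (λ j → ∑[ k < N ] g j k)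
  (λ j j<M → ∑-cong N (f j) (g j) (λ k → h j k j<M))

∑∑-+ : ∀ M N (f g : ℕ → ℕ → ℚ) → ∑∑ M N (λ j k → f j k + g j k) ≡ ∑∑ M N f + ∑∑ M N g
∑∑-+ M N f g = trans
  (∑-cong M (λ j → ∑[ k < N ] (f j k + g j k)) (λ j → (∑[ k < N ] f j k) + (∑[ k < N ] g j k))
    (λ j _ → ∑-+ N (f j) (g j)))
  (∑-+ M (λ j → ∑[ k < N ] f j k) (λ j → ∑[ k < N ] g j k))

∑∑-*ˡ : ∀ M N c (f : ℕ → ℕ → ℚ) → ∑∑ M N (λ j k → c * f j k) ≡ c * ∑∑ M N f
∑∑-*ˡ M N c f = trans
  (∑-cong M (λ j → ∑[ k < N ] (c * f j k)) (λ j → c * (∑[ k < N ] f j k)) (λ j _ → ∑-*ˡ N c (f j)))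
  (∑-*ˡ M c (λ j → ∑[ k < N ] f j k))

∑*∑ : ∀ M N (f g : ℕ → ℚ) → (∑[ j < M ] f j) * (∑[ k < N ] g k) ≡ ∑∑ M N (λ j k → f j * g k)
∑*∑ M N f g = trans (sym (∑-*ʳ M f (∑[ k < N ] g k)))
  (∑-cong M (λ j → f j * (∑[ k < N ] g k)) (λ j → ∑[ k < N ] (f j * g k))
    (λ j _ → sym (∑-*ˡ N (f j) g)))

pairing : ℕ → ℕ → ℕ → ℚ
pairing N j k = ∑[ x < N ] (rise (- fromℕ x) k * rise (1ℚ + fromℕ x) j)

∑-bilinear : ∀ X J K (b a : ℕ → ℚ) →
  ∑[ x < X ] ((∑[ j < J ] (b j * rise (1ℚ + fromℕ x) j)) * (∑[ k < K ] (a k * rise (- fromℕ x) k)))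
  ≡ ∑∑ J K (λ j k → b j * a k * pairing X j k)
∑-bilinear X J K b a = begin
  ∑[ x < X ] ((∑[ j < J ] (b j * up x j)) * (∑[ k < K ] (a k * down x k)))
    ≡⟨ ∑-cong X (λ x → (∑[ j < J ] (b j * up x j)) * (∑[ k < K ] (a k * down x k)))
         (λ x → ∑∑ J K (λ j k → b j * up x j * (a k * down x k)))
         (λ x _ → ∑*∑ J K (λ j → b j * up x j) (λ k → a k * down x k)) ⟩
  ∑[ x < X ] (∑[ j < J ] (∑[ k < K ] (b j * up x j * (a k * down x k))))
    ≡⟨ ∑-swap X J (λ x j → ∑[ k < K ] (b j * up x j * (a k * down x k))) ⟩
  ∑[ j < J ] (∑[ x < X ] (∑[ k < K ] (b j * up x j * (a k * down x k))))
    ≡⟨ ∑-cong J (λ j → ∑[ x < X ] (∑[ k < K ] (b j * up x j * (a k * down x k))))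
         (λ j → ∑[ k < K ] (∑[ x < X ] (b j * up x j * (a k * down x k))))
         (λ j _ → ∑-swap X K (λ x k → b j * up x j * (a k * down x k))) ⟩
  ∑[ j < J ] (∑[ k < K ] (∑[ x < X ] (b j * up x j * (a k * down x k))))
    ≡⟨ ∑∑-cong J K (λ j k → ∑[ x < X ] (b j * up x j * (a k * down x k)))
         (λ j k → b j * a k * pairing X j k) (λ j k _ _ → factor j k) ⟩
  ∑∑ J K (λ j k → b j * a k * pairing X j k) ∎
  where
  open ≡-Reasoning
  up down : ℕ → ℕ → ℚ
  up x j = rise (1ℚ + fromℕ x) j
  down x k = rise (- fromℕ x) k
  alg : ∀ b u a d → b * u * (a * d) ≡ b * a * (d * u)
  alg = solve-∀ ring
  factor : ∀ j k → ∑[ x < X ] (b j * up x j * (a k * down x k)) ≡ b j * a k * pairing X j k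
  factor j k = trans
    (∑-cong X (λ x → b j * up x j * (a k * down x k)) (λ x → b j * a k * (down x k * up x j))
      (λ x _ → alg (b j) (up x j) (a k) (down x k)))
    (∑-*ˡ X (b j * a k) (λ x → down x k * up x j))

module OddParameters (n : ℕ) (p-prime : Prime (suc (n ℕ.+ n))) where

  open OddPrime n p-prime public

  u v d : ℕ → ℚ
  u = rise (1ℚ + P)
  v = rise (1ℚ - P)
  d = legendre (fromℕ n)

  ε : ℚ
  ε = (- 1ℚ) ^ n

  ε-integral : ∀ m → Integral ((- 1ℚ) ^ m)
  ε-integral zero    = fromℤ-integral 1ℤ
  ε-integral (suc m) = *-integral (neg-integral (fromℤ-integral 1ℤ)) (ε-integral m)

  d-integral : ∀ k → k ≤ n ℕ.+ n → Integral (d k)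
  d-integral k k≤2n = *-integral (rise-integral k (neg-integral (fromℕ-integral n)) k≤2n)
    (rise-integral k (+-integral (fromℤ-integral 1ℤ) (fromℕ-integral n)) k≤2n)

  pairing-p : ∀ j k → pairing p j k ≡ P * recip (j ℕ.+ k) * (u j * v k)
  pairing-p j k = alg (fromℕ (j ℕ.+ k)) (recip (j ℕ.+ k)) P (u j) (v k) (pairing p j k)
    (recip-inverse (j ℕ.+ k)) (rise-hockey-stick j k p)
    where
    alg : ∀ s i p u v S → (1ℚ + s) * i ≡ 1ℚ → (1ℚ + s) * S ≡ p * (v * u) → S ≡ p * i * (u * v)
    alg s i p u v S h h′ = linear (- S · h ⊞ i · h′) (solve (s ∷ i ∷ p ∷ u ∷ v ∷ S ∷ []) ring)

  -- Only the Legendre factor is reflected, so that products of functions of 1 + x and -x appear and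
  -- the hockey stick identity applies. The coefficients `a` are arbitrary because the same formula
  -- treats the squares and the cross term.
  reflected-sum : ∀ K (a : ℕ → ℚ) →
    ∑[ x < p ] (Φₙ n (- fromℕ x) * (∑[ k < K ] (a k * rise (- fromℕ x) k)))
    ≡ ε * ∑∑ (suc n) K (λ j k → d j * a k * pairing p j k)
  reflected-sum K a = begin
    ∑[ x < p ] (Φₙ n (- fromℕ x) * G x)
      ≡⟨ ∑-cong p (λ x → Φₙ n (- fromℕ x) * G x) (λ x → ε * (Φₙ n (1ℚ + fromℕ x) * G x))
           (λ x _ → trans (cong (_* G x) (Φₙ-reflection n x)) (*-assoc ε (Φₙ n (1ℚ + fromℕ x)) (G x))) ⟩
    ∑[ x < p ] (ε * (Φₙ n (1ℚ + fromℕ x) * G x))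
      ≡⟨ ∑-*ˡ p ε (λ x → Φₙ n (1ℚ + fromℕ x) * G x) ⟩
    ε * (∑[ x < p ] (Φₙ n (1ℚ + fromℕ x) * G x))
      ≡⟨ cong (ε *_) (∑-bilinear p (suc n) K d a) ⟩
    ε * ∑∑ (suc n) K (λ j k → d j * a k * pairing p j k) ∎
    where
    open ≡-Reasoning
    G : ℕ → ℚ
    G x = ∑[ k < K ] (a k * rise (- fromℕ x) k)

  weight : ℕ → ℕ → ℚ
  weight j k = d j * d k * (P * recip (j ℕ.+ k))

  weight-symmetric : ∀ j k → weight j k ≡ weight k j
  weight-symmetric j k = cong₂ _*_ (*-comm (d j) (d k)) (cong (λ i → P * recip i) (ℕₚ.+-comm j k))

  -- The factor p = 2n + 1 is the inverse of the squared norm of the Legendre polynomial.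
  weight-total : ∑∑ (suc n) (suc n) weight ≡ 1ℚ
  weight-total = trans
    (∑∑-cong (suc n) (suc n) weight (λ j k → P * (d j * d k * recip (j ℕ.+ k)))
      (λ j k _ _ → alg (d j) (d k) P (recip (j ℕ.+ k))))
    (trans (∑∑-*ˡ (suc n) (suc n) P (λ j k → d j * d k * recip (j ℕ.+ k)))
      (trans (cong (_* ∑∑ (suc n) (suc n) (λ j k → d j * d k * recip (j ℕ.+ k))) (fromℕ-suc (n ℕ.+ n)))
             (legendre-norm n)))
    where
    alg : ∀ a b p i → a * b * (p * i) ≡ p * (a * b * i)
    alg = solve-∀ ring

  T : ℚ
  T = ∑∑ (suc n) (suc n) (λ j k → d j * d k * pairing p j k)

  T≡weighted : T ≡ ∑∑ (suc n) (suc n) (λ j k → weight j k * (u j * v k))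
  T≡weighted = ∑∑-cong (suc n) (suc n) (λ j k → d j * d k * pairing p j k) (λ j k → weight j k * (u j * v k))
    (λ j k _ _ → trans (cong (d j * d k *_) (pairing-p j k))
                       (sym (*-assoc (d j * d k) (P * recip (j ℕ.+ k)) (u j * v k))))

  T≡transposed : T ≡ ∑∑ (suc n) (suc n) (λ j k → weight j k * (u k * v j))
  T≡transposed = trans T≡weighted (trans (∑-swap (suc n) (suc n) (λ j k → weight j k * (u j * v k)))
    (∑∑-cong (suc n) (suc n) (λ j k → weight k j * (u k * v j)) (λ j k → weight j k * (u k * v j))
      (λ j k _ _ → cong (_* (u k * v j)) (weight-symmetric k j))))

  -- Add `T≡weighted` and `T≡transposed` and subtract twice the total weight 1.
  symmetrised : ∑∑ (suc n) (suc n) (λ j k → weight j k * (u j * v k + u k * v j - 2ℚ)) ≡ 2ℚ * (T - 1ℚ)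
  symmetrised = begin
    ∑∑ N N (λ j k → weight j k * (u j * v k + u k * v j - 2ℚ))
      ≡⟨ ∑∑-cong N N (λ j k → weight j k * (u j * v k + u k * v j - 2ℚ))
           (λ j k → weight j k * (u j * v k) + (weight j k * (u k * v j) + - 2ℚ * weight j k))
           (λ j k _ _ → expand (weight j k) (u j * v k) (u k * v j)) ⟩
    ∑∑ N N (λ j k → weight j k * (u j * v k) + (weight j k * (u k * v j) + - 2ℚ * weight j k))
      ≡⟨ ∑∑-+ N N (λ j k → weight j k * (u j * v k)) (λ j k → weight j k * (u k * v j) + - 2ℚ * weight j k) ⟩
    ∑∑ N N (λ j k → weight j k * (u j * v k)) + ∑∑ N N (λ j k → weight j k * (u k * v j) + - 2ℚ * weight j k)
      ≡⟨ cong₂ _+_ (sym T≡weighted) (∑∑-+ N N (λ j k → weight j k * (u k * v j)) (λ j k → - 2ℚ * weight j k)) ⟩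
    T + (∑∑ N N (λ j k → weight j k * (u k * v j)) + ∑∑ N N (λ j k → - 2ℚ * weight j k))
      ≡⟨ cong (λ r → T + r) (cong₂ _+_ (sym T≡transposed)
           (trans (∑∑-*ˡ N N (- 2ℚ) weight) (cong (- 2ℚ *_) weight-total))) ⟩
    T + (T + - 2ℚ * 1ℚ)
      ≡⟨ collect T ⟩
    2ℚ * (T - 1ℚ) ∎
    where
    open ≡-Reasoning
    N = suc n
    expand : ∀ w a b → w * (a + b - 2ℚ) ≡ w * a + (w * b + - 2ℚ * w)
    expand = solve-∀ ring
    collect : ∀ t → t + (t + - 2ℚ * 1ℚ) ≡ 2ℚ * (t - 1ℚ)
    collect = solve-∀ ring

  <1+n⇒≤2n : ∀ {k} → k < suc n → k ≤ n ℕ.+ n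
  <1+n⇒≤2n k<1+n = ℕₚ.≤-trans (ℕ.s≤s⁻¹ k<1+n) (ℕₚ.m≤m+n n n)

  corner : ∀ {j k} → j < suc n → k < suc n → n ℕ.+ n ≤ j ℕ.+ k → j ≡ n × k ≡ n
  corner {j} {k} (s≤s j≤n) (s≤s k≤n) 2n≤j+k =
    ℕₚ.≤-antisym j≤n (ℕₚ.+-cancelʳ-≤ n n j (ℕₚ.≤-trans 2n≤j+k (ℕₚ.+-monoʳ-≤ j k≤n))) ,
    ℕₚ.≤-antisym k≤n (ℕₚ.+-cancelˡ-≤ n n k (ℕₚ.≤-trans 2n≤j+k (ℕₚ.+-monoˡ-≤ k j≤n)))

  -- For j + k < 2n the weight gives one factor p and the bracket two. At the corner j = k = n the
  -- factor `P * recip (n + n)` is 1, so the bracket, which is 2(uₙvₙ - 1) there, has to supply all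
  -- three.
  symmetrised-divisible : Divisible 1 (A n) → ∀ j k → j < suc n → k < suc n →
    Divisible 3 (weight j k * (u j * v k + u k * v j - 2ℚ))
  symmetrised-divisible p∣A j k j≤n k≤n with j ℕ.+ k ℕₚ.<? n ℕ.+ n
  ... | yes j+k<2n = *-divisible {1} {2}
    (alg (d j) (d k) P (recip (j ℕ.+ k))
      ∵ *-integral (*-integral (d-integral j (<1+n⇒≤2n j≤n)) (d-integral k (<1+n⇒≤2n k≤n))) (recip-small j+k<2n)
        ⊙ p-divisible)
    (rise-symmetrised-mod-p² j k (<1+n⇒≤2n j≤n) (<1+n⇒≤2n k≤n))
    where
    alg : ∀ a b p i → a * b * (p * i) ≡ a * b * i * p
    alg = solve-∀ ring
  ... | no j+k≮2n with corner j≤n k≤n (ℕₚ.≮⇒≥ j+k≮2n)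
  ... | refl , refl =
    alg (d n) P (recip (n ℕ.+ n)) (u n) (v n) (A n) (recip-inverse′ (n ℕ.+ n))
    ∵ *-integral (fromℕ-integral 2) (*-integral (d-integral n (<1+n⇒≤2n j≤n)) (d-integral n (<1+n⇒≤2n j≤n)))
      ⊙ (rise-product-mod-p³ n (<1+n⇒≤2n j≤n) ⊕ neg-divisible (*-divisible p²-divisible p∣A))
    where
    alg : ∀ d p i u v a → p * i ≡ 1ℚ → d * d * (p * i) * (u * v + u * v - 2ℚ) ≡
          fromℕ 2 * (d * d) * ((u * v - (1ℚ - p * p * a)) + - (p * p * a))
    alg d p i u v a h = linear (d * d * (u * v + u * v - 2ℚ) · h) (solve (d ∷ p ∷ i ∷ u ∷ v ∷ a ∷ []) ring)

  Φₙ-squares-mod-p³ : 2 < n ℕ.+ n →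
    Divisible 3 ((∑[ x < p ] (Φₙ n (- fromℕ x) * Φₙ n (- fromℕ x))) - ε)
  Φₙ-squares-mod-p³ 2<2n = trans (cong (_- ε) (reflected-sum (suc n) d)) (alg ε T)
    ∵ *-integral (ε-integral n) (½-integral (ℕₚ.<-trans (s<s z<s) 2<2n))
      ⊙ (sym symmetrised ∵ ∑-divisible (suc n) (λ j → ∑[ k < suc n ] (weight j k * (u j * v k + u k * v j - 2ℚ)))
           (λ j j≤n → ∑-divisible (suc n) (λ k → weight j k * (u j * v k + u k * v j - 2ℚ))
             (λ k k≤n → symmetrised-divisible (A-divisible 2<2n) j k j≤n k≤n)))
    where
    alg : ∀ e t → e * t - e ≡ e * ½ * (2ℚ * (t - 1ℚ))
    alg = solve-∀ ring

-- Comparison with the hypergeometric series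

fromℕ-inverse : ∀ m .{{_ : ℕ.NonZero m}} → fromℕ m * (+ 1 / m) ≡ 1ℚ
fromℕ-inverse (suc m) = trans (cong (fromℕ (suc m) *_) (↥p/↧p≡p (recip m))) (recip-inverse′ m)

1^n≡1 : ∀ n → 1ℚ ^ n ≡ 1ℚ
1^n≡1 zero    = refl
1^n≡1 (suc n) = trans (*-identityˡ (1ℚ ^ n)) (1^n≡1 n)

pochhammer≡rise*! : ∀ a k → pochhammer a k ≡ rise a k * fromℕ (k !)
pochhammer≡rise*! a zero    = refl
pochhammer≡rise*! a (suc k) = alg (pochhammer a k) (rise a k) (a + fromℕ k) (recip k) (fromℕ (suc k))
  (fromℕ (k !)) (fromℕ (suc k !)) (pochhammer≡rise*! a k) (fromℕ-* (suc k) (k !)) (recip-inverse′ k)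
  where
  alg : ∀ q r s i t f g → q ≡ r * f → g ≡ t * f → t * i ≡ 1ℚ → q * s ≡ r * s * i * g
  alg q r s i t f g h₁ h₂ h₃ = linear (s · h₁ ⊞ - (r * s * i) · h₂ ⊞ - (r * s * f) · h₃)
    (solve (q ∷ r ∷ s ∷ i ∷ t ∷ f ∷ g ∷ []) ring)

-- With both lower parameters equal to 1 the denominator is k!³, one k! for each upper Pochhammer
-- symbol.
₃F₂-term≡ : ∀ a b z k → ₃F₂-term a b z 1ℚ 1ℚ 1ℚ k ≡ coeff a b k * rise z k
₃F₂-term≡ a b z k = alg (pochhammer a k) (pochhammer b k) (pochhammer z k) (pochhammer 1ℚ k)
  ((1/ pochhammer 1ℚ k) {{pochhammer≢0 1-lowerParameter k}}) (1ℚ ^ k) ((+ 1 / (k !)) {{k ℕₚ.!≢0}})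
  (fromℕ (k !)) (rise a k) (rise b k) (rise z k)
  (pochhammer≡rise*! a k) (pochhammer≡rise*! b k) (pochhammer≡rise*! z k)
  (trans (pochhammer≡rise*! 1ℚ k) (trans (cong (_* fromℕ (k !)) (rise-1 k)) (*-identityˡ (fromℕ (k !)))))
  (*-inverseʳ (pochhammer 1ℚ k) {{pochhammer≢0 1-lowerParameter k}})
  (1^n≡1 k) (fromℕ-inverse (k !) {{k ℕₚ.!≢0}})
  where
  alg : ∀ A B C q i e w f r s t → A ≡ r * f → B ≡ s * f → C ≡ t * f → q ≡ f →
        q * i ≡ 1ℚ → e ≡ 1ℚ → f * w ≡ 1ℚ → A * B * C * i * i * (e * w) ≡ r * s * t
  alg _ _ _ _ i _ w f r s t refl refl refl refl h refl h′ = linear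
    (r * s * t * (f * w * (1ℚ + f * i)) · h ⊞ r * s * t · h′) (solve (i ∷ w ∷ f ∷ r ∷ s ∷ t ∷ []) ring)

-- The natural bound x + 1 depends on x; a common bound M lets the sums over x and k be
-- interchanged.
₃F₂≡Φ : ∀ a b {x M} → x < M →
  ₃F₂ a b (- fromℕ x) 1ℚ 1ℚ 1ℚ (terminates a b x 1ℚ 1ℚ 1ℚ) ≡ Φ a b M (- fromℕ x)
₃F₂≡Φ a b {x} {M} x<M = trans
  (series-unique (₃F₂-term a b (- fromℕ x) 1ℚ 1ℚ 1ℚ) (terminates a b x 1ℚ 1ℚ 1ℚ)
    (M , λ k M≤k → proj₂ (terminates a b x 1ℚ 1ℚ 1ℚ) k (ℕₚ.<-≤-trans x<M M≤k)))
  (∑-cong M (₃F₂-term a b (- fromℕ x) 1ℚ 1ℚ 1ℚ) (λ k → coeff a b k * rise (- fromℕ x) k)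
    (λ k _ → ₃F₂-term≡ a b (- fromℕ x) k))

legendre-truncates : ∀ n M z → n < M → Φ (- fromℕ n) (1ℚ + fromℕ n) M z ≡ Φₙ n z
legendre-truncates n M z n<M = series-unique (λ k → legendre (fromℕ n) k * rise z k)
  (M , λ k M≤k → vanish k (ℕₚ.<-≤-trans n<M M≤k)) (suc n , vanish)
  where
  vanish : ∀ k → n < k → legendre (fromℕ n) k * rise z k ≡ 0ℚ
  vanish k n<k = trans (cong (_* rise z k) (legendre-vanishes n n<k)) (*-zeroˡ (rise z k))

/2≡*½ : ∀ i → i / 2 ≡ fromℤ i * ½
/2≡*½ i = cong (_/ 2) (sym (ℤₚ.*-identityʳ i))

even⊎odd : ∀ m → (∃[ k ] m ≡ k ℕ.+ k) ⊎ (∃[ k ] m ≡ suc (k ℕ.+ k))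
even⊎odd zero = inj₁ (0 , refl)
even⊎odd (suc m) with even⊎odd m
... | inj₁ (k , refl) = inj₂ (k , refl)
... | inj₂ (k , refl) = inj₁ (suc k , cong suc (sym (ℕₚ.+-suc k k)))

odd-prime : ∀ {p} → Prime p → 2 < p → ∃[ n ] p ≡ suc (n ℕ.+ n)
odd-prime {p} p-prime 2<p with even⊎odd p
... | inj₂ odd = odd
... | inj₁ (k , refl) with prime⇒irreducible p-prime (∣.divides {2} k (trans (cong (k ℕ.+_) (sym (ℕₚ.+-identityʳ k))) (ℕₚ.*-comm 2 k)))
...   | inj₁ ()
...   | inj₂ eq = contradiction 2<p (ℕₚ.<-irrefl eq)

half-double : ∀ n → (n ℕ.+ n) ℕ./ 2 ≡ n
half-double n = trans (cong (ℕ._/ 2) (trans (cong (n ℕ.+_) (sym (ℕₚ.+-identityʳ n))) (ℕₚ.*-comm 2 n))) (m*n/n≡m n 2)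

module _ (n : ℕ) (p-prime : Prime (suc (n ℕ.+ n))) where

  open OddParameters n p-prime

  lower-parameter : (1ℤ ℤ.- + p) / 2 ≡ - fromℕ n
  lower-parameter = trans (/2≡*½ (1ℤ ℤ.- + p)) (alg (fromℤ (1ℤ ℤ.- + p)) (fromℤ (ℤ.- + p)) P (fromℕ n)
    (fromℤ-+ 1ℤ (ℤ.- + p)) (fromℤ-neg (+ p)) P≡1+2n)
    where
    alg : ∀ x y p n → x ≡ 1ℚ + y → y ≡ - p → p ≡ 1ℚ + 2ℚ * n → x * ½ ≡ - n
    alg _ _ _ n refl refl refl = solve (n ∷ []) ring

  upper-parameter : (1ℤ ℤ.+ + p) / 2 ≡ 1ℚ + fromℕ n
  upper-parameter = trans (/2≡*½ (1ℤ ℤ.+ + p)) (alg (fromℤ (1ℤ ℤ.+ + p)) P (fromℕ n)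
    (fromℤ-+ 1ℤ (+ p)) P≡1+2n)
    where
    alg : ∀ x p n → x ≡ 1ℚ + p → p ≡ 1ℚ + 2ℚ * n → x * ½ ≡ 1ℚ + n
    alg _ _ n refl refl = solve (n ∷ []) ring

  ₃F₂≡Φₙ : ∀ x → x < p →
    ₃F₂ ((1ℤ ℤ.- + p) / 2) ((1ℤ ℤ.+ + p) / 2) (- fromℕ x) 1ℚ 1ℚ 1ℚ
      (terminates ((1ℤ ℤ.- + p) / 2) ((1ℤ ℤ.+ + p) / 2) x 1ℚ 1ℚ 1ℚ) ≡ Φₙ n (- fromℕ x)
  ₃F₂≡Φₙ x x<p = trans (₃F₂≡Φ ((1ℤ ℤ.- + p) / 2) ((1ℤ ℤ.+ + p) / 2) x<p)
    (trans (cong₂ (λ a b → Φ a b p (- fromℕ x)) lower-parameter upper-parameter)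
           (legendre-truncates n p (- fromℕ x) (s≤s (ℕₚ.m≤m+n n n))))

∑-squares : ∀ N (f g : ℕ → ℚ) → (∀ x → x < N → f x ≡ g x) → ∑[ x < N ] (f x ^ 2) ≡ ∑[ x < N ] (g x * g x)
∑-squares N f g h = ∑-cong N (λ x → f x ^ 2) (λ x → g x * g x)
  (λ x x<N → cong₂ _*_ (h x x<N) (trans (*-identityʳ (f x)) (h x x<N)))

-- The parameters ½

module HalfParameters (n : ℕ) (p-prime : Prime (suc (n ℕ.+ n))) (2<2n : 2 < n ℕ.+ n) where

  open OddParameters n p-prime

  d′ : ℕ → ℚ
  d′ = coeff ½ ½

  -- The recurrence is that of d′ minus that of d, divided by p².
  e : ℕ → ℚ
  e zero    = 0ℚ
  e (suc k) = ½ * ½ * recip² k * ((1ℚ + 2ℚ * fromℕ k) * (1ℚ + 2ℚ * fromℕ k) * e k + d k)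

  -- Since p = 2n + 1, the numerator (k - n)(k + n + 1) equals ((2k+1)² - p²)/4. Dropping p² gives
  -- the recurrence of `d′`.
  d-suc : ∀ k → d (suc k) ≡ ½ * ½ * recip² k * (((1ℚ + 2ℚ * fromℕ k) * (1ℚ + 2ℚ * fromℕ k) - P * P) * d k)
  d-suc k = alg (fromℕ n) (fromℕ k) (recip k) P (rise (- fromℕ n) k) (rise (1ℚ + fromℕ n) k) P≡1+2n
    where
    alg : ∀ n k i p α β → p ≡ 1ℚ + 2ℚ * n → α * (- n + k) * i * (β * (1ℚ + n + k) * i)
          ≡ ½ * ½ * (i * i) * (((1ℚ + 2ℚ * k) * (1ℚ + 2ℚ * k) - p * p) * (α * β))
    alg n k i _ α β refl = solve (n ∷ k ∷ i ∷ α ∷ β ∷ []) ring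

  d′≡d+p²e : ∀ k → d′ k ≡ d k + P * P * e k
  d′≡d+p²e zero    = alg P
    where
    alg : ∀ p → 1ℚ * 1ℚ ≡ 1ℚ * 1ℚ + p * p * 0ℚ
    alg = solve-∀ ring
  d′≡d+p²e (suc k) = alg (fromℕ k) (recip k) P (rise ½ k) (d k) (d (suc k)) (e k) (d′≡d+p²e k) (d-suc k)
    where
    alg : ∀ k i p γ d d⁺ e → γ * γ ≡ d + p * p * e →
          d⁺ ≡ ½ * ½ * (i * i) * (((1ℚ + 2ℚ * k) * (1ℚ + 2ℚ * k) - p * p) * d) →
          γ * (½ + k) * i * (γ * (½ + k) * i)
          ≡ d⁺ + p * p * (½ * ½ * (i * i) * ((1ℚ + 2ℚ * k) * (1ℚ + 2ℚ * k) * e + d))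
    alg k i p γ d d⁺ e h h′ = linear ((½ + k) * i * ((½ + k) * i) · h ⊞ - 1ℚ · h′)
      (solve (k ∷ i ∷ p ∷ γ ∷ d ∷ d⁺ ∷ e ∷ []) ring)

  ½-int : Integral ½
  ½-int = ½-integral (ℕₚ.<-trans (s<s z<s) 2<2n)

  odd-int : ∀ k → Integral (1ℚ + 2ℚ * fromℕ k)
  odd-int k = +-integral (fromℤ-integral 1ℤ) (*-integral (fromℕ-integral 2) (fromℕ-integral k))

  ¼recip²-int : ∀ {k} → k < n ℕ.+ n → Integral (½ * ½ * recip² k)
  ¼recip²-int k<2n = *-integral (*-integral ½-int ½-int) (*-integral (recip-small k<2n) (recip-small k<2n))

  e-integral : ∀ k → k ≤ n ℕ.+ n → Integral (e k)
  e-integral zero    k≤2n = fromℤ-integral +0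
  e-integral (suc k) k<2n = *-integral (¼recip²-int k<2n)
    (+-integral (*-integral (*-integral (odd-int k) (odd-int k)) (e-integral k (ℕₚ.<⇒≤ k<2n)))
                (d-integral k (ℕₚ.<⇒≤ k<2n)))

  -- The quotient of `d′ k` by `d k` is the product of (2i+1)²/((2i+1)² - p²) over i < k, hence 1 +
  -- p² `O k` to first order in p². For k ≤ n every 2i + 1 that occurs is less than p.
  e≡dO : ∀ k → k ≤ n → Divisible 1 (e k - d k * O k)
  e≡dO zero    k≤n = refl ∵ 0-divisible
  e≡dO (suc k) k<n =
    alg (fromℕ k) (fromℕ (k ℕ.+ k)) (recip k) (recip (k ℕ.+ k)) P (d k) (d (suc k)) (e k) (O k) (O (suc k))
        (fromℕ-double k) (d-suc k) (∑-last k (λ i → recip² (i ℕ.+ i))) (recip-inverse (k ℕ.+ k))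
    ∵ *-integral (¼recip²-int k<2n) (*-integral (odd-int k) (odd-int k)) ⊙ e≡dO k (ℕₚ.<⇒≤ k<n)
      ⊕ *-integral (¼recip²-int k<2n) (*-integral (*-integral (d-integral k (ℕₚ.<⇒≤ k<2n)) (+-integral O-int (*-integral t-int t-int)))
          (fromℕ-integral p)) ⊙ p-divisible
    where
    k<2n : k < n ℕ.+ n
    k<2n = ℕₚ.<-≤-trans k<n (ℕₚ.m≤m+n n n)
    t-int : Integral (recip (k ℕ.+ k))
    t-int = recip-small (ℕₚ.+-mono-< k<n k<n)
    O-int : Integral (O k)
    O-int = ∑-integral k (λ i → recip² (i ℕ.+ i)) (λ i i<k →
      let i<n = ℕₚ.<-trans i<k k<n
          r = recip-small {i ℕ.+ i} (ℕₚ.+-mono-< i<n i<n) in *-integral r r)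
    alg : ∀ k s i t p d d⁺ e o o⁺ → s ≡ 2ℚ * k →
          d⁺ ≡ ½ * ½ * (i * i) * (((1ℚ + 2ℚ * k) * (1ℚ + 2ℚ * k) - p * p) * d) →
          o⁺ ≡ o + t * t → (1ℚ + s) * t ≡ 1ℚ →
          ½ * ½ * (i * i) * ((1ℚ + 2ℚ * k) * (1ℚ + 2ℚ * k) * e + d) - d⁺ * o⁺
          ≡ ½ * ½ * (i * i) * ((1ℚ + 2ℚ * k) * (1ℚ + 2ℚ * k)) * (e - d * o)
            + ½ * ½ * (i * i) * (d * (o + t * t) * p) * p
    alg k _ i t p d _ e o _ refl refl refl h = linear
      (- (½ * ½ * (i * i) * d * (1ℚ + (1ℚ + 2ℚ * k) * t)) · h)
      (solve (k ∷ i ∷ t ∷ p ∷ d ∷ e ∷ o ∷ []) ring)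

  -- The products of `e` and `d` on the antidiagonal.

  D : ℚ
  D = d n * d n

  -- (2i+2)² e(n+1+i) d(n-1-i) ≡ (2i+1)² e(n+1+i) d(n-i), by the recurrence for d modulo p.
  e-descend : ∀ i l → i ℕ.+ suc l ≡ n →
    Divisible 1 ((1ℚ + 2ℚ * fromℕ i) * (1ℚ + 2ℚ * fromℕ i) * e (suc (i ℕ.+ n)) * d (suc l) - D) →
    Divisible 1
    ((1ℚ + (1ℚ + 2ℚ * fromℕ i)) * (1ℚ + (1ℚ + 2ℚ * fromℕ i)) * e (suc (i ℕ.+ n)) * d l - D)
  e-descend i l eq ahead =
    alg (fromℕ i) (fromℕ l) (recip l) (fromℕ n) P (e (suc (i ℕ.+ n))) (d l) (d (suc l)) D
        P≡1+2n
        (trans (cong fromℕ (sym eq)) (trans (fromℕ-+ i (suc l)) (cong (λ r → fromℕ i + r) (fromℕ-suc l))))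
        (recip-inverse l) (d-suc l)
    ∵ ahead
      ⊕ *-integral e-int (+-integral (*-integral (*-integral (fromℕ-integral 2) (+-integral (fromℤ-integral 1ℤ) (odd-int i)))
                                                 (d-integral l (ℕₚ.<⇒≤ l<2n)))
                                     (*-integral (+-integral (fromℕ-integral p) (neg-integral (*-integral (fromℕ-integral 2) (odd-int i))))
                                                 (d-integral (suc l) l<2n))) ⊙ p-divisible
    where
    l<n : l < n
    l<n = subst (l <_) eq (ℕₚ.m≤n+m (suc l) i)
    l<2n : l < n ℕ.+ n
    l<2n = ℕₚ.<-≤-trans l<n (ℕₚ.m≤m+n n n)
    i<n : i < n
    i<n = subst (i <_) eq (ℕₚ.m<m+n i z<s)
    e-int : Integral (e (suc (i ℕ.+ n)))
    e-int = e-integral (suc (i ℕ.+ n)) (ℕₚ.+-monoˡ-≤ n i<n)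
    alg : ∀ i l r n p e d d⁺ D → p ≡ 1ℚ + 2ℚ * n → n ≡ i + (1ℚ + l) → (1ℚ + l) * r ≡ 1ℚ →
          d⁺ ≡ ½ * ½ * (r * r) * (((1ℚ + 2ℚ * l) * (1ℚ + 2ℚ * l) - p * p) * d) →
          (1ℚ + (1ℚ + 2ℚ * i)) * (1ℚ + (1ℚ + 2ℚ * i)) * e * d - D
          ≡ ((1ℚ + 2ℚ * i) * (1ℚ + 2ℚ * i) * e * d⁺ - D)
            + e * (2ℚ * (1ℚ + (1ℚ + 2ℚ * i)) * d + (p + - (2ℚ * (1ℚ + 2ℚ * i))) * d⁺) * p
    -- Here 2l + 1 = p - (2i+2) and 2l + 2 = p - (2i+1), which turns the recurrence at l into one in
    -- i modulo p.
    alg i l r _ _ e d d⁺ D refl refl h h′ = linear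
      (e * (((1ℚ + 2ℚ * l) * (1ℚ + 2ℚ * l)
             - (1ℚ + 2ℚ * (i + (1ℚ + l))) * (1ℚ + 2ℚ * (i + (1ℚ + l)))) * d) * - (1ℚ + (1ℚ + l) * r) · h
       ⊞ - (4ℚ * e * (1ℚ + l) * (1ℚ + l)) · h′)
      (solve (i ∷ l ∷ r ∷ e ∷ d ∷ d⁺ ∷ D ∷ []) ring)

  e-suc : ∀ k → (2ℚ + 2ℚ * fromℕ k) * (2ℚ + 2ℚ * fromℕ k) * e (suc k)
                ≡ (1ℚ + 2ℚ * fromℕ k) * (1ℚ + 2ℚ * fromℕ k) * e k + d k
  e-suc k = alg (fromℕ k) (recip k) (e k) (d k) (recip-inverse k)
    where
    alg : ∀ k i e d → (1ℚ + k) * i ≡ 1ℚ →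
      (2ℚ + 2ℚ * k) * (2ℚ + 2ℚ * k) * (½ * ½ * (i * i) * ((1ℚ + 2ℚ * k) * (1ℚ + 2ℚ * k) * e + d))
      ≡ (1ℚ + 2ℚ * k) * (1ℚ + 2ℚ * k) * e + d
    alg k i e d h = linear ((1ℚ + (1ℚ + k) * i) * ((1ℚ + 2ℚ * k) * (1ℚ + 2ℚ * k) * e + d) · h)
      (solve (k ∷ i ∷ e ∷ d ∷ []) ring)

  -- Induction on i, with l + 1 = n - i. For i = 0 the recurrence of `e` at n reads (p+1)² e(n+1) =
  -- p² e(n) + d(n). Beyond n the term d vanishes, so modulo p the recurrence becomes (2i+3)²
  -- e(n+2+i) ≡ (2i+2)² e(n+1+i), and `e-descend` lowers the index of d to match.
  e-ahead : ∀ i l → i ℕ.+ suc l ≡ n → Divisible 1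
    ((1ℚ + 2ℚ * fromℕ i) * (1ℚ + 2ℚ * fromℕ i) * e (suc (i ℕ.+ n)) * d (suc l) - D)
  e-ahead zero l eq = subst
    (λ m → Divisible 1 ((1ℚ + 2ℚ * 0ℚ) * (1ℚ + 2ℚ * 0ℚ) * e (suc n) * d m - D)) (sym eq) (
    alg (fromℕ n) P (e n) (e (suc n)) (d n) P≡1+2n (e-suc n)
    ∵ *-integral (d-integral n (ℕₚ.m≤m+n n n))
        (+-integral (*-integral (fromℕ-integral p) (e-integral n (ℕₚ.m≤m+n n n)))
          (neg-integral (*-integral (e-integral (suc n) 1+<1+n⇒≤2n) (+-integral (fromℕ-integral 2) (fromℕ-integral p)))))
      ⊙ p-divisible)
    where
    1+<1+n⇒≤2n : suc n ≤ n ℕ.+ n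
    1+<1+n⇒≤2n = ℕₚ.+-monoˡ-≤ n (positive n 2<2n)
      where
      positive : ∀ n → 2 < n ℕ.+ n → 1 ≤ n
      positive (suc n) _ = s≤s z≤n
    alg : ∀ n p e e⁺ d → p ≡ 1ℚ + 2ℚ * n →
      (2ℚ + 2ℚ * n) * (2ℚ + 2ℚ * n) * e⁺ ≡ (1ℚ + 2ℚ * n) * (1ℚ + 2ℚ * n) * e + d →
      (1ℚ + 2ℚ * 0ℚ) * (1ℚ + 2ℚ * 0ℚ) * e⁺ * d - d * d ≡ d * (p * e + - (e⁺ * (2ℚ + p))) * p
    alg n _ e e⁺ d refl h = linear (d · h) (solve (n ∷ e ∷ e⁺ ∷ d ∷ []) ring)
  e-ahead (suc i) l eq =
    alg (fromℕ i) (fromℕ (suc i)) (fromℕ n) (fromℕ (suc (i ℕ.+ n))) P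
      (e (suc (i ℕ.+ n))) (e (suc (suc (i ℕ.+ n)))) (d (suc l)) (d (suc (i ℕ.+ n))) D
      P≡1+2n (fromℕ-suc i) (trans (fromℕ-suc (i ℕ.+ n)) (cong (λ r → 1ℚ + r) (fromℕ-+ i n)))
      (legendre-vanishes n (s≤s (ℕₚ.m≤n+m n i))) (e-suc (suc (i ℕ.+ n)))
    ∵ e-descend i (suc l) eq′ (e-ahead i (suc l) eq′)
      ⊕ *-integral (*-integral e-int (+-integral
            (*-integral (fromℕ-integral 2) (+-integral (fromℤ-integral 1ℤ) (odd-int i)))
            (fromℕ-integral p))) d-int
        ⊙ p-divisible
      ⊕ neg-divisible (*-integral (*-integral e⁺-int (+-integral
            (*-integral (fromℕ-integral 2) (+-integral (fromℕ-integral 2) (odd-int i)))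
            (fromℕ-integral p))) d-int
        ⊙ p-divisible)
    where
    i<n : suc i ≤ n
    i<n = subst (suc i ≤_) eq (ℕₚ.m≤m+n (suc i) (suc l))
    eq′ : i ℕ.+ suc (suc l) ≡ n
    eq′ = trans (ℕₚ.+-suc i (suc l)) eq
    d-int : Integral (d (suc l))
    d-int = d-integral (suc l) (ℕₚ.≤-trans (subst (suc l ≤_) eq (ℕₚ.m≤n+m (suc l) (suc i))) (ℕₚ.m≤m+n n n))
    e-int : Integral (e (suc (i ℕ.+ n)))
    e-int = e-integral (suc (i ℕ.+ n)) (ℕₚ.+-monoˡ-≤ n i<n)
    e⁺-int : Integral (e (suc (suc (i ℕ.+ n))))
    e⁺-int = e-integral (suc (suc (i ℕ.+ n))) (ℕₚ.+-monoˡ-≤ n (subst (suc i <_) eq (ℕₚ.m<m+n (suc i) z<s)))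
    alg : ∀ i i⁺ n k p e e⁺ d dₖ D → p ≡ 1ℚ + 2ℚ * n → i⁺ ≡ 1ℚ + i → k ≡ 1ℚ + (i + n) → dₖ ≡ 0ℚ →
      (2ℚ + 2ℚ * k) * (2ℚ + 2ℚ * k) * e⁺ ≡ (1ℚ + 2ℚ * k) * (1ℚ + 2ℚ * k) * e + dₖ →
      (1ℚ + 2ℚ * i⁺) * (1ℚ + 2ℚ * i⁺) * e⁺ * d - D
      ≡ ((1ℚ + (1ℚ + 2ℚ * i)) * (1ℚ + (1ℚ + 2ℚ * i)) * e * d - D)
        + e * (2ℚ * (1ℚ + (1ℚ + 2ℚ * i)) + p) * d * p
        + - (e⁺ * (2ℚ * (2ℚ + (1ℚ + 2ℚ * i)) + p) * d * p)
    alg i _ n _ _ e e⁺ d _ D refl refl refl refl h = linear (d · h) (solve (i ∷ n ∷ e ∷ e⁺ ∷ d ∷ D ∷ []) ring)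

  -- Division of `e-descend` by (2i+2)², which is prime to p because i < n.
  e-antidiagonal : ∀ i l → i ℕ.+ suc l ≡ n → Divisible 1 (e (suc (i ℕ.+ n)) * d l - D * (½ * ½ * recip² i))
  e-antidiagonal i l eq = alg (fromℕ i) (recip i) (e (suc (i ℕ.+ n))) (d l) D (recip-inverse i)
    ∵ ¼recip²-int (ℕₚ.<-≤-trans (subst (i <_) eq (ℕₚ.m<m+n i z<s)) (ℕₚ.m≤m+n n n))
      ⊙ e-descend i l eq (e-ahead i l eq)
    where
    alg : ∀ i r e d D → (1ℚ + i) * r ≡ 1ℚ → e * d - D * (½ * ½ * (r * r)) ≡
      ½ * ½ * (r * r) * ((1ℚ + (1ℚ + 2ℚ * i)) * (1ℚ + (1ℚ + 2ℚ * i)) * e * d - D)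
    alg i r e d D h = linear (- ((1ℚ + (1ℚ + i) * r) * (e * d)) · h) (solve (i ∷ r ∷ e ∷ d ∷ D ∷ []) ring)

  -- The pairing modulo p and the cross term.

  rise≡1 : ∀ q k → Divisible 1 q → k ≤ n ℕ.+ n → Divisible 1 (rise (1ℚ + q) k - 1ℚ)
  rise≡1 q k q∈p k≤2n = alg q (H k) (rise (1ℚ + q) k)
    ∵ divisible-pred (rise-mod-p² q k q∈p k≤2n) ⊕ H-integral k k≤2n ⊙ q∈p
    where
    alg : ∀ q h r → r - 1ℚ ≡ (r - (1ℚ + q * h)) + h * q
    alg = solve-∀ ring

  u-integral : ∀ j → j ≤ n ℕ.+ n → Integral (u j)
  u-integral j = rise-integral j (+-integral (fromℤ-integral 1ℤ) (fromℕ-integral p))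

  v-integral : ∀ k → k ≤ n ℕ.+ n → Integral (v k)
  v-integral k = rise-integral k (+-integral (fromℤ-integral 1ℤ) (neg-integral (fromℕ-integral p)))

  pairing-diagonal : ∀ j k → j ℕ.+ k ≡ n ℕ.+ n → Divisible 1 (pairing p j k - 1ℚ)
  pairing-diagonal j k eq =
    alg P (recip (j ℕ.+ k)) (u j) (v k) (pairing p j k) (pairing-p j k)
      (trans (cong (λ m → P * recip m) eq) (recip-inverse′ (n ℕ.+ n)))
    ∵ v-integral k k≤2n ⊙ rise≡1 P j p-divisible j≤2n ⊕ rise≡1 (- P) k (neg-divisible p-divisible) k≤2n
    where
    j≤2n : j ≤ n ℕ.+ n
    j≤2n = subst (j ≤_) eq (ℕₚ.m≤m+n j k)
    k≤2n : k ≤ n ℕ.+ n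
    k≤2n = subst (k ≤_) eq (ℕₚ.m≤n+m k j)
    alg : ∀ p i u v S → S ≡ p * i * (u * v) → p * i ≡ 1ℚ → S - 1ℚ ≡ v * (u - 1ℚ) + (v - 1ℚ)
    alg p i u v S h h′ = linear (1ℚ · h ⊞ u * v · h′) (solve (p ∷ i ∷ u ∷ v ∷ S ∷ []) ring)

  -- The number j + k + 1 lies strictly between 0 and 2p, so p can divide it only if it equals p.
  pairing-off-diagonal : ∀ j k → j < suc n → k < p → j ℕ.+ k ≢ n ℕ.+ n → Divisible 1 (pairing p j k)
  pairing-off-diagonal j k j≤n k<p j+k≢2n =
    trans (pairing-p j k) (alg P (recip (j ℕ.+ k)) (u j) (v k))
    ∵ *-integral (recip-integral (j ℕ.+ k) p∤1+j+k)
        (*-integral (u-integral j (<1+n⇒≤2n j≤n)) (v-integral k (ℕ.s≤s⁻¹ k<p))) ⊙ p-divisible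
    where
    alg : ∀ p i u v → p * i * (u * v) ≡ i * (u * v) * p
    alg = solve-∀ ring
    small : suc (j ℕ.+ k) < p ℕ.+ p
    small = ℕₚ.+-mono-≤-< {suc j} {p} {k} {p} (ℕₚ.≤-trans j≤n (s≤s (ℕₚ.m≤m+n n n))) k<p
    p∤1+j+k : p ∤ suc (j ℕ.+ k)
    p∤1+j+k (∣.divides zero ())
    p∤1+j+k (∣.divides 1 eq) = j+k≢2n (ℕₚ.suc-injective (trans eq (ℕₚ.*-identityˡ p)))
    p∤1+j+k (∣.divides (suc (suc q)) eq) = ℕₚ.<⇒≱ small (ℕₚ.≤-trans (ℕₚ.m≤m+n (p ℕ.+ p) (q ℕ.* p))
      (ℕₚ.≤-reflexive (trans (ℕₚ.+-assoc p p (q ℕ.* p)) (sym eq))))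

  ∑-single : ∀ N (f : ℕ → ℚ) m → m < N → (∀ k → k < N → k ≢ m → Divisible 1 (f k)) →
             Divisible 1 ((∑[ k < N ] f k) - f m)
  ∑-single (suc N) f zero    m<N h = alg (f 0) (∑[ k < N ] f (suc k))
    ∵ ∑-divisible N (f ∘ suc) (λ k k<N → h (suc k) (s<s k<N) (λ ()))
    where
    alg : ∀ a b → a + b - a ≡ b
    alg = solve-∀ ring
  ∑-single (suc N) f (suc m) m<N h = alg (f 0) (∑[ k < N ] f (suc k)) (f (suc m))
    ∵ h 0 z<s (λ ()) ⊕ ∑-single N (f ∘ suc) m (ℕ.s<s⁻¹ m<N)
        (λ k k<N k≢m → h (suc k) (s<s k<N) (k≢m ∘ ℕₚ.suc-injective))
    where
    alg : ∀ a b c → a + b - c ≡ a + (b - c)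
    alg = solve-∀ ring

  antidiagonal : ℚ
  antidiagonal = ∑[ j < suc n ] (d j * e (n ∸ j ℕ.+ n))

  -- Modulo p the pairing is the indicator of j + k = 2n, so each row retains the single index k =
  -- 2n - j.
  cross≡antidiagonal : Divisible 1 (∑∑ (suc n) p (λ j k → d j * e k * pairing p j k) - antidiagonal)
  cross≡antidiagonal = ∑-congruent (suc n) (λ j → ∑[ k < p ] (d j * e k * pairing p j k)) (λ j → d j * e (n ∸ j ℕ.+ n)) row
    where
    row : ∀ j → j < suc n → Divisible 1 ((∑[ k < p ] (d j * e k * pairing p j k)) - d j * e (n ∸ j ℕ.+ n))
    row j j≤n = alg (∑[ k < p ] (d j * e k * pairing p j k)) (d j) (e m) (pairing p j m)
      ∵ ∑-single p (λ k → d j * e k * pairing p j k) m (s≤s m≤2n)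
          (λ k k<p k≢m → *-integral (d-integral j (<1+n⇒≤2n j≤n)) (e-integral k (ℕ.s≤s⁻¹ k<p))
            ⊙ pairing-off-diagonal j k j≤n k<p
                (λ eq → k≢m (ℕₚ.+-cancelˡ-≡ j k m (trans eq (sym j+m≡2n)))))
        ⊕ *-integral (d-integral j (<1+n⇒≤2n j≤n)) (e-integral m m≤2n) ⊙ pairing-diagonal j m j+m≡2n
      where
      m = n ∸ j ℕ.+ n
      j+m≡2n : j ℕ.+ m ≡ n ℕ.+ n
      j+m≡2n = trans (sym (ℕₚ.+-assoc j (n ∸ j) n)) (cong (ℕ._+ n) (ℕₚ.m+[n∸m]≡n (ℕ.s≤s⁻¹ j≤n)))
      m≤2n : m ≤ n ℕ.+ n
      m≤2n = subst (m ≤_) j+m≡2n (ℕₚ.m≤n+m m j)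
      alg : ∀ S d e t → S - d * e ≡ (S - d * e * t) + d * e * (t - 1ℚ)
      alg = solve-∀ ring

  -- The term j = n gives D times the sum over odd numbers by `e≡dO`; the terms j = n - 1 - i give
  -- D/(2i+2)², the even numbers. Since `O n` is congruent to `A n`/4, the total is D times `A n`/2.
  antidiagonal-divisible : Divisible 1 antidiagonal
  antidiagonal-divisible =
    trans (∑-last n (λ j → d j * e (n ∸ j ℕ.+ n)))
      (trans (cong₂ (λ S m → S + d n * e (m ℕ.+ n)) (∑-reverse n (λ j → d j * e (n ∸ j ℕ.+ n))) (ℕₚ.n∸n≡0 n))
        (alg (∑[ i < n ] (d (n ∸ suc i) * e (n ∸ (n ∸ suc i) ℕ.+ n))) (∑[ i < n ] (D * (½ * ½ * recip² i)))
             (d n) (e n) (O n) (A n)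
             (trans (∑-*ˡ n D (λ i → ½ * ½ * recip² i)) (cong (D *_) (∑-*ˡ n (½ * ½) recip²)))))
    ∵ ∑-congruent n (λ i → d (n ∸ suc i) * e (n ∸ (n ∸ suc i) ℕ.+ n)) (λ i → D * (½ * ½ * recip² i)) term
      ⊕ dₙ-int ⊙ e≡dO n ℕₚ.≤-refl
      ⊕ *-integral dₙ-int dₙ-int ⊙ (O≡A/4 ⊕ ½-int ⊙ A-divisible 2<2n)
    where
    dₙ-int : Integral (d n)
    dₙ-int = d-integral n (ℕₚ.m≤m+n n n)
    term : ∀ i → i < n → Divisible 1 (d (n ∸ suc i) * e (n ∸ (n ∸ suc i) ℕ.+ n) - D * (½ * ½ * recip² i))
    term i i<n =
      cong (_- D * (½ * ½ * recip² i)) (trans (*-comm (d (n ∸ suc i)) _)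
        (cong (λ m → e (m ℕ.+ n) * d (n ∸ suc i)) (ℕₚ.m∸[m∸n]≡n i<n)))
      ∵ e-antidiagonal i (n ∸ suc i) (trans (ℕₚ.+-suc i (n ∸ suc i)) (ℕₚ.m+[n∸m]≡n i<n))
    alg : ∀ S S′ d e o a → S′ ≡ d * d * (½ * ½ * a) → S + d * e ≡
      (S - S′) + d * (e - d * o) + d * d * ((o - ½ * ½ * a) + ½ * a)
    alg S S′ d e o a h = linear (1ℚ · h) (solve (S ∷ S′ ∷ d ∷ e ∷ o ∷ a ∷ []) ring)

  -- The sum of squares for the parameters ½.

  F E : ℕ → ℚ
  F x = Φₙ n (- fromℕ x)
  E x = ∑[ k < p ] (e k * rise (- fromℕ x) k)

  cross-divisible : Divisible 1 (∑[ x < p ] (F x * E x))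
  cross-divisible = trans (reflected-sum p e)
      (alg ε (∑∑ (suc n) p (λ j k → d j * e k * pairing p j k)) antidiagonal)
    ∵ ε-integral n ⊙ (cross≡antidiagonal ⊕ antidiagonal-divisible)
    where
    alg : ∀ ε c a → ε * c ≡ ε * ((c - a) + a)
    alg = solve-∀ ring

  E-integral : ∀ x → Integral (E x)
  E-integral x = ∑-integral p (λ k → e k * rise (- fromℕ x) k)
    (λ k k<p → *-integral (e-integral k (ℕ.s≤s⁻¹ k<p))
                          (rise-integral k (neg-integral (fromℕ-integral x)) (ℕ.s≤s⁻¹ k<p)))

  Φ½≡F+p²E : ∀ x → Φ ½ ½ p (- fromℕ x) ≡ F x + P * P * E x
  Φ½≡F+p²E x = begin
    ∑[ k < p ] (d′ k * r k)
      ≡⟨ ∑-cong p (λ k → d′ k * r k) (λ k → d k * r k + P * P * (e k * r k))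
           (λ k _ → trans (cong (_* r k) (d′≡d+p²e k)) (alg (d k) (P * P) (e k) (r k))) ⟩
    ∑[ k < p ] (d k * r k + P * P * (e k * r k))
      ≡⟨ ∑-+ p (λ k → d k * r k) (λ k → P * P * (e k * r k)) ⟩
    (∑[ k < p ] (d k * r k)) + (∑[ k < p ] (P * P * (e k * r k)))
      ≡⟨ cong₂ _+_ (legendre-truncates n p (- fromℕ x) (s≤s (ℕₚ.m≤m+n n n)))
                   (∑-*ˡ p (P * P) (λ k → e k * r k)) ⟩
    F x + P * P * E x ∎
    where
    open ≡-Reasoning
    r : ℕ → ℚ
    r = rise (- fromℕ x)
    alg : ∀ d q e r → (d + q * e) * r ≡ d * r + q * (e * r)
    alg = solve-∀ ring

  sum-of-squares : ∑[ x < p ] (Φ ½ ½ p (- fromℕ x) * Φ ½ ½ p (- fromℕ x))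
    ≡ (∑[ x < p ] (F x * F x)) + (2ℚ * (P * P * (∑[ x < p ] (F x * E x))) + P * (P * (P * P)) * (∑[ x < p ] (E x * E x)))
  sum-of-squares = begin
    ∑[ x < p ] (Φ ½ ½ p (- fromℕ x) * Φ ½ ½ p (- fromℕ x))
      ≡⟨ ∑-cong p (λ x → Φ ½ ½ p (- fromℕ x) * Φ ½ ½ p (- fromℕ x))
           (λ x → F x * F x + (2ℚ * (P * P) * (F x * E x) + P * (P * (P * P)) * (E x * E x)))
           (λ x _ → trans (cong (λ r → r * r) (Φ½≡F+p²E x)) (alg (F x) (E x) P)) ⟩
    ∑[ x < p ] (F x * F x + (2ℚ * (P * P) * (F x * E x) + P * (P * (P * P)) * (E x * E x)))
      ≡⟨ ∑-+ p (λ x → F x * F x) (λ x → 2ℚ * (P * P) * (F x * E x) + P * (P * (P * P)) * (E x * E x)) ⟩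
    FF + (∑[ x < p ] (2ℚ * (P * P) * (F x * E x) + P * (P * (P * P)) * (E x * E x)))
      ≡⟨ cong (λ r → FF + r) (∑-+ p (λ x → 2ℚ * (P * P) * (F x * E x)) (λ x → P * (P * (P * P)) * (E x * E x))) ⟩
    FF + ((∑[ x < p ] (2ℚ * (P * P) * (F x * E x))) + (∑[ x < p ] (P * (P * (P * P)) * (E x * E x))))
      ≡⟨ cong (λ r → FF + r) (cong₂ _+_
           (trans (∑-*ˡ p (2ℚ * (P * P)) (λ x → F x * E x)) (*-assoc 2ℚ (P * P) (∑[ x < p ] (F x * E x))))
           (∑-*ˡ p (P * (P * (P * P))) (λ x → E x * E x))) ⟩
    FF + (2ℚ * (P * P * (∑[ x < p ] (F x * E x))) + P * (P * (P * P)) * (∑[ x < p ] (E x * E x))) ∎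
    where
    open ≡-Reasoning
    FF = ∑[ x < p ] (F x * F x)
    alg : ∀ f e p → (f + p * p * e) * (f + p * p * e) ≡ f * f + (2ℚ * (p * p) * (f * e) + p * (p * (p * p)) * (e * e))
    alg = solve-∀ ring

  Φ½-squares-mod-p³ : Divisible 3 ((∑[ x < p ] (Φ ½ ½ p (- fromℕ x) * Φ ½ ½ p (- fromℕ x))) - ε)
  Φ½-squares-mod-p³ = trans (cong (_- ε) sum-of-squares)
      (alg (∑[ x < p ] (F x * F x)) (P * P * (∑[ x < p ] (F x * E x))) (∑[ x < p ] (E x * E x)) P ε)
    ∵ Φₙ-squares-mod-p³ 2<2n
      ⊕ fromℕ-integral 2 ⊙ *-divisible p²-divisible cross-divisible
      ⊕ *-integral (fromℕ-integral p) (∑-integral p (λ x → E x * E x) (λ x _ → *-integral (E-integral x) (E-integral x)))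
        ⊙ *-divisible p-divisible p²-divisible
    where
    alg : ∀ S c s p ε → S + (2ℚ * c + p * (p * (p * p)) * s) - ε ≡ (S - ε) + fromℕ 2 * c + p * s * (p * (p * p))
    alg = solve-∀ ring

-- The congruences for the hypergeometric sums.

hypergeometric-squares-½ : ∀ n → Prime (suc (n ℕ.+ n)) → 2 < n ℕ.+ n →
  (∑[ x < suc (n ℕ.+ n) ] (₃F₂ ½ ½ (- fromℕ x) 1ℚ 1ℚ 1ℚ (terminates ½ ½ x 1ℚ 1ℚ 1ℚ) ^ 2))
    ≡ (- 1ℚ) ^ ((n ℕ.+ n) ℕ./ 2) [mod suc (n ℕ.+ n) ^ 3 ]
hypergeometric-squares-½ n p-prime 2<2n = subst₂ (λ S e → S ≡ e [mod p ^ 3 ])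
  (sym (∑-squares p (λ x → ₃F₂ ½ ½ (- fromℕ x) 1ℚ 1ℚ 1ℚ (terminates ½ ½ x 1ℚ 1ℚ 1ℚ))
         (λ x → Φ ½ ½ p (- fromℕ x)) (λ x x<p → ₃F₂≡Φ ½ ½ x<p)))
  (cong ((- 1ℚ) ^_) (sym (half-double n)))
  (Divisible⇒mod {3} {∑[ x < p ] (Φ ½ ½ p (- fromℕ x) * Φ ½ ½ p (- fromℕ x))} {(- 1ℚ) ^ n}
    Φ½-squares-mod-p³)
  where
  open OddParameters n p-prime
  open HalfParameters n p-prime 2<2n

-- The prime 3 is evaluated directly, because `A-divisible` inverts 3; for n = 1 the sum `A n` is 1.
hypergeometric-squares-½-at-3 :
  (∑[ x < 3 ] (₃F₂ ½ ½ (- fromℕ x) 1ℚ 1ℚ 1ℚ (terminates ½ ½ x 1ℚ 1ℚ 1ℚ) ^ 2))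
    ≡ (- 1ℚ) ^ (2 ℕ./ 2) [mod 3 ^ 3 ]
hypergeometric-squares-½-at-3 =
  -- The values at x = 0, 1, 2 are 1, 3/4 and 41/64. Their squares add up to 8081/4096, and 8081 +
  -- 4096 = 27 · 451.
  + 451 / 4096 , Coprimality.gcd≡1⇒coprime {3} {4096} refl , refl

hypergeometric-squares-[1∓p]/2 : ∀ n → Prime (suc (n ℕ.+ n)) → 2 < n ℕ.+ n →
  let p = suc (n ℕ.+ n)
      a = (1ℤ ℤ.- + p) / 2
      b = (1ℤ ℤ.+ + p) / 2
  in (∑[ x < p ] (₃F₂ a b (- fromℕ x) 1ℚ 1ℚ 1ℚ (terminates a b x 1ℚ 1ℚ 1ℚ) ^ 2))
       ≡ (- 1ℚ) ^ ((n ℕ.+ n) ℕ./ 2) [mod p ^ 3 ]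
hypergeometric-squares-[1∓p]/2 n p-prime 2<2n = subst₂ (λ S e → S ≡ e [mod p ^ 3 ])
  (sym (∑-squares p (λ x → ₃F₂ a b (- fromℕ x) 1ℚ 1ℚ 1ℚ (terminates a b x 1ℚ 1ℚ 1ℚ))
         (λ x → Φₙ n (- fromℕ x)) (₃F₂≡Φₙ n p-prime)))
  (cong ((- 1ℚ) ^_) (sym (half-double n)))
  (Divisible⇒mod {3} {∑[ x < p ] (Φₙ n (- fromℕ x) * Φₙ n (- fromℕ x))} {(- 1ℚ) ^ n}
    (Φₙ-squares-mod-p³ 2<2n))
  where
  open OddParameters n p-prime
  a b : ℚ
  a = (1ℤ ℤ.- + p) / 2
  b = (1ℤ ℤ.+ + p) / 2

theorem2 :
    ((p : ℕ) → Prime p → 3 < p →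
      let a = (1ℤ ℤ.- + p) / 2
          b = (1ℤ ℤ.+ + p) / 2
      in (∑[ x < p ] (₃F₂ a b (- fromℕ x) 1ℚ 1ℚ 1ℚ (terminates a b x 1ℚ 1ℚ 1ℚ) ^ 2))
           ≡ (- 1ℚ) ^ ((p ∸ 1) ℕ./ 2) [mod p ^ 3 ])
    ×
    ((p : ℕ) → Prime p → 3 ≤ p →
      (∑[ x < p ] (₃F₂ ½ ½ (- fromℕ x) 1ℚ 1ℚ 1ℚ (terminates ½ ½ x 1ℚ 1ℚ 1ℚ) ^ 2))
        ≡ (- 1ℚ) ^ ((p ∸ 1) ℕ./ 2) [mod p ^ 3 ])
theorem2 = first , second
  where
  first : (p : ℕ) → Prime p → 3 < p →
    (∑[ x < p ] (₃F₂ ((1ℤ ℤ.- + p) / 2) ((1ℤ ℤ.+ + p) / 2) (- fromℕ x) 1ℚ 1ℚ 1ℚ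
                  (terminates ((1ℤ ℤ.- + p) / 2) ((1ℤ ℤ.+ + p) / 2) x 1ℚ 1ℚ 1ℚ) ^ 2))
      ≡ (- 1ℚ) ^ ((p ∸ 1) ℕ./ 2) [mod p ^ 3 ]
  first p p-prime 3<p with odd-prime p-prime (ℕₚ.<⇒≤ 3<p)
  ... | n , refl = hypergeometric-squares-[1∓p]/2 n p-prime (ℕ.s<s⁻¹ 3<p)

  second : (p : ℕ) → Prime p → 3 ≤ p →
    (∑[ x < p ] (₃F₂ ½ ½ (- fromℕ x) 1ℚ 1ℚ 1ℚ (terminates ½ ½ x 1ℚ 1ℚ 1ℚ) ^ 2))
      ≡ (- 1ℚ) ^ ((p ∸ 1) ℕ./ 2) [mod p ^ 3 ]
  second p p-prime 3≤p with ℕₚ.m≤n⇒m<n∨m≡n 3≤p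
  ... | inj₂ refl = hypergeometric-squares-½-at-3
  ... | inj₁ 3<p with odd-prime p-prime 3≤p
  ...   | n , refl = hypergeometric-squares-½ n p-prime (ℕ.s<s⁻¹ 3<p)
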